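{- Let $k$ and $n$ be non-negative integers. For each $i$ with $1\leq i\leq k+1$, let $p_i$ be a prime number with $p_i\geq 5$ and $p_i\equiv 5,7,11 \pmod{12}$. Then, for any integer $j\not\equiv 0 \pmod{p_{k+1}}$, \[ \sigma mex\left(p_1^2\cdots p_{k+1}^2\, n + p_1^2\cdots p_k^2\, p_{k+1}\, j + \frac{p_1^2\cdots p_k^2\, p_{k+1}^2-1}{12}\right)\equiv 0 \pmod 4 . \]
   Context: For a partition $\pi$ of a positive integer $n$, $mex(\pi)$ is the smallest positive integer that is not a part of $\pi$. For a positive integer $n$, $\sigma mex(n)=\sum_{\pi} mex(\pi)$, summed over all partitions $\pi$ of $n$, and $\sigma mex(0)=1$. Equivalently, $\sum_{n\geq 0}\sigma mex(n)q^n=(-q;q)_\infty^2$, where $(a;q)_\infty=\prod_{m\geq 1}(1-aq^{m-1})$. -}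

module Defs where

open import Data.Nat using (ℕ; zero; suc; _+_; _*_; _∸_; _^_; _≤?_; _≟_)
open import Data.Nat.ListAction using (sum)
open import Data.List using (List; []; _∷_; map; concatMap; replicate; _++_; length; upTo)
open import Data.List.Membership.DecPropositional _≟_ using (_∈?_)
open import Data.Integer as ℤ using (ℤ; +_; -[1+_])
open import Relation.Nullary using (yes; no)

-- partitionsLE m n : all partitions of n (as non-increasing lists of
-- positive parts) whose parts are all ≤ m.  Each partition appears exactly once:
-- for the largest allowed part (suc m) we choose its multiplicity c.
partitionsLE : ℕ → ℕ → List (List ℕ)
partitionsLE zero zero    = [] ∷ []
partitionsLE zero (suc n) = []
partitionsLE (suc m) n =
  concatMap (λ c → pick c (c * suc m ≤? n)) (upTo (suc n))
  where
  pick : (c : ℕ) → _ → List (List ℕ)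
  pick c (yes _) = map (replicate c (suc m) ++_) (partitionsLE m (n ∸ c * suc m))
  pick c (no _)  = []

partitions : ℕ → List (List ℕ)
partitions n = partitionsLE n n

mexFrom : ℕ → ℕ → List ℕ → ℕ
mexFrom zero    k xs = k
mexFrom (suc f) k xs with k ∈? xs
... | yes _ = mexFrom f (suc k) xs
... | no  _ = k

-- mex(π): the smallest positive integer that is not a part of π
-- (fuel length π + 1 suffices, since π has at most length π distinct parts)
mex : List ℕ → ℕ
mex π = mexFrom (suc (length π)) 1 π

σmex : ℕ → ℕ
σmex n = sum (map mex (partitions n))

-- extension to integer arguments: σmex of a negative integer is 0
-- (coefficient of q^N in (-q;q)_∞^2 for N < 0)
σmexℤ : ℤ → ℕ
σmexℤ (+ n)    = σmex n
σmexℤ -[1+ n ] = 0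

prodSq : (ℕ → ℕ) → ℕ → ℕ
prodSq p zero    = 1
prodSq p (suc k) = prodSq p k * (p (suc k) ^ 2)

{-# OPTIONS --safe #-}
-- Splitting off the multiplicity of the largest part shows Σ σmex(n) qⁿ = ψ/f, where f = ∏(1 - qⁱ) and
-- ψ = Σ q^(k(k+1)/2).  With D = ∏(1 - q²ⁱ) and φ = Σ (-1)ⁿ q^(n²) = 1 + 2X, Gauss's identities say
-- ψf = D² and Dφ = f².  Squaring the latter gives ψ/f ≡ f² (mod 4), so σmex(N) modulo 4 is the coefficient
-- of q^N in f·f = D·φ.  By Euler's pentagonal number theorem, f·f only contains exponents N for which
-- 2(12N + 1) = a² + b², and D·φ only those for which 12N + 1 = a² + 12b².  In the theorem a prime p divides
-- 12N + 1 to an odd power, which rules out the first if p ≡ 3 (mod 4) and the second if p ≡ 2 (mod 3).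
-- The three theta identities are instances of one recurrence for a finite Rogers–Fine sum.
module Submission where

open import Defs
open import Level using (Level; _⊔_; 0ℓ)
open import Algebra.Bundles using (CommutativeRing)
open import Function.Base using (_∘_; id)
open import Data.Maybe.Base using (Maybe; just; nothing)
open import Data.Nat.Base as ℕ using (ℕ; zero; suc; z≤n; s≤s; NonZero)
import Data.Nat.Properties as ℕₚ
open import Data.Nat.Tactic.RingSolver using (solve-∀)
open import Data.Integer as ℤ using (ℤ; +_; -[1+_]; 0ℤ; 1ℤ)
import Data.Integer.Properties as ℤₚ
import Data.Integer.Tactic.RingSolver as ℤ-Solver
import Data.Sign.Base as Sign
open import Data.Product using (Σ; ∃; ∃₂; _,_; proj₁; proj₂)
open import Relation.Nullary using (¬_; Dec; yes; no)
open import Relation.Binary.PropositionalEquality as ≡ using (_≡_; _≢_)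

-- Integer coefficients for the ring solver

-- The exponent N is fixed and the work takes place in ℤ[q]/(q^(N+1)). There the products and theta
-- sums are finite, and every 1 - qⁱ with i ≥ 1 is cancellable because qⁱ is nilpotent; this
-- replaces limits and inverses of power series. The identities themselves are proved in any
-- commutative ring with a nilpotent q: `W n z` is evaluated twice at the end of a diagonal, once by
-- a recurrence that advances n and z together, which yields the theta series, and once by z(β - α)
-- = 0, which yields the product. Congruence modulo 4 is expressed by an explicit Y with S = f² - 4Y
-- over ℤ, read off in degree N. Two quadratic forms occur because neither covers all residues: 5 is
-- 1 modulo 4 and 7 is 1 modulo 3. For the N of the theorem, 12N + 1 = Q²pt with p the last prime, Q
-- the product of the others and t = 12pn + 12j + p, so that p ∤ t comes from p ∤ j. The primes may
-- repeat, so p may divide Q; only the parity of the valuation is controlled.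

module IntegerCoefficients {c ℓ : Level} (R : CommutativeRing c ℓ) where
  open CommutativeRing R
  open import Algebra.Properties.Ring ring
  open import Algebra.Properties.AbelianGroup +-abelianGroup using (⁻¹-∙-comm)
  open import Algebra.Properties.Semiring.Mult.TCOptimised semiring using (_×_; ×-homo-+; ×1-homo-*; 1+×)
  open import Algebra.Solver.Ring.AlmostCommutativeRing using (_-Raw-AlmostCommutative⟶_; fromCommutativeRing)
  open import Relation.Binary.Reasoning.Setoid setoid

  ⟦_⟧ℤ : ℤ → Carrier
  ⟦ + n ⟧ℤ      = n × 1#
  ⟦ -[1+ n ] ⟧ℤ = - (suc n × 1#)

  +-cancel-shift : ∀ a x y → (a + x) - (a + y) ≈ x - y
  +-cancel-shift a x y = begin
    (a + x) - (a + y)       ≈⟨ +-congˡ (⁻¹-∙-comm a y) ⟨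
    (a + x) + (- a - y)     ≈⟨ +-congʳ (+-comm a x) ⟩
    (x + a) + (- a - y)     ≈⟨ +-assoc x a _ ⟩
    x + (a + (- a - y))     ≈⟨ +-congˡ (+-assoc a (- a) _) ⟨
    x + ((a - a) - y)       ≈⟨ +-congˡ (+-congʳ (-‿inverseʳ a)) ⟩
    x + (0# - y)            ≈⟨ +-congˡ (+-identityˡ _) ⟩
    x - y                   ∎

  ⊖-homo : ∀ m n → ⟦ m ℤ.⊖ n ⟧ℤ ≈ m × 1# - n × 1#
  ⊖-homo zero zero       = sym (-‿inverseʳ 0#)
  ⊖-homo zero (suc n)    = sym (+-identityˡ _)
  ⊖-homo (suc m) zero    = sym (trans (+-congˡ -0#≈0#) (+-identityʳ _))
  ⊖-homo (suc m) (suc n) = begin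
    ⟦ suc m ℤ.⊖ suc n ⟧ℤ                ≡⟨ ≡.cong ⟦_⟧ℤ (ℤₚ.[1+m]⊖[1+n]≡m⊖n m n) ⟩
    ⟦ m ℤ.⊖ n ⟧ℤ                        ≈⟨ ⊖-homo m n ⟩
    m × 1# - n × 1#                     ≈⟨ +-cancel-shift 1# _ _ ⟨
    (1# + m × 1#) - (1# + n × 1#)       ≈⟨ +-cong (1+× m 1#) (-‿cong (1+× n 1#)) ⟨
    suc m × 1# - suc n × 1#             ∎

  +-homo : ∀ i j → ⟦ i ℤ.+ j ⟧ℤ ≈ ⟦ i ⟧ℤ + ⟦ j ⟧ℤ
  +-homo (+ m) (+ n)           = ×-homo-+ 1# m n
  +-homo (+ m) -[1+ n ]        = ⊖-homo m (suc n)
  +-homo -[1+ m ] (+ n)        = trans (⊖-homo n (suc m)) (+-comm _ _)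
  +-homo -[1+ m ] -[1+ n ]     = begin
    - (suc (suc (m ℕ.+ n)) × 1#)         ≡⟨ ≡.cong (λ k → - (suc k × 1#)) (ℕₚ.+-suc m n) ⟨
    - ((suc m ℕ.+ suc n) × 1#)           ≈⟨ -‿cong (×-homo-+ 1# (suc m) (suc n)) ⟩
    - (suc m × 1# + suc n × 1#)          ≈⟨ ⁻¹-∙-comm _ _ ⟨
    - (suc m × 1#) - suc n × 1#          ∎

  ◃-homo : ∀ n → ⟦ Sign.- ℤ.◃ n ⟧ℤ ≈ - (n × 1#)
  ◃-homo zero    = sym -0#≈0#
  ◃-homo (suc n) = refl

  *-homo : ∀ i j → ⟦ i ℤ.* j ⟧ℤ ≈ ⟦ i ⟧ℤ * ⟦ j ⟧ℤ
  *-homo (+ m) (+ n)       = trans (reflexive (≡.cong ⟦_⟧ℤ (≡.sym (ℤₚ.pos-* m n)))) (×1-homo-* m n)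
  *-homo (+ m) -[1+ n ]    =
    trans (◃-homo (m ℕ.* suc n)) (trans (-‿cong (×1-homo-* m (suc n))) (-‿distribʳ-* _ _))
  *-homo -[1+ m ] (+ n)    =
    trans (◃-homo (suc m ℕ.* n)) (trans (-‿cong (×1-homo-* (suc m) n)) (-‿distribˡ-* _ _))
  *-homo -[1+ m ] -[1+ n ] = begin
    (suc m ℕ.* suc n) × 1#               ≈⟨ ×1-homo-* (suc m) (suc n) ⟩
    (suc m × 1#) * (suc n × 1#)          ≈⟨ -‿involutive _ ⟨
    - - ((suc m × 1#) * (suc n × 1#))    ≈⟨ -‿cong (-‿distribʳ-* _ _) ⟩
    - ((suc m × 1#) * - (suc n × 1#))    ≈⟨ -‿distribˡ-* _ _ ⟩
    - (suc m × 1#) * - (suc n × 1#)      ∎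

  neg-homo : ∀ i → ⟦ ℤ.- i ⟧ℤ ≈ - ⟦ i ⟧ℤ
  neg-homo (+ zero)   = sym -0#≈0#
  neg-homo (+ suc n)  = refl
  neg-homo -[1+ n ]   = sym (-‿involutive _)

  ℤ-morphism : ℤ.+-*-rawRing -Raw-AlmostCommutative⟶ (fromCommutativeRing R)
  ℤ-morphism = record
    { ⟦_⟧    = ⟦_⟧ℤ
    ; +-homo = +-homo
    ; *-homo = *-homo
    ; -‿homo = neg-homo
    ; 0-homo = refl
    ; 1-homo = refl
    }

  -- Equality in the ring need not be decidable, so the solver compares coefficients in ℤ, where
  -- cancellation can be detected.
  _coefficient≟_ : ∀ i j → Maybe (⟦ i ⟧ℤ ≈ ⟦ j ⟧ℤ)
  i coefficient≟ j with i ℤₚ.≟ j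
  ... | yes i≡j = just (reflexive (≡.cong ⟦_⟧ℤ i≡j))
  ... | no  _   = nothing

  open import Algebra.Solver.Ring ℤ.+-*-rawRing (fromCommutativeRing R) ℤ-morphism _coefficient≟_
    public using (solve; _:=_; _:+_; _:*_; _:-_; :-_; con)

-- Theta identities

-- Recursive rather than `n + n`, so that `qfactorial q (double (suc n))` and `ψ (double (suc n))`
-- unfold by two factors or terms.
double : ℕ → ℕ
double zero    = zero
double (suc n) = suc (suc (double n))

double≡n+n : ∀ n → double n ≡ n ℕ.+ n
double≡n+n zero    = ≡.refl
double≡n+n (suc n) = ≡.cong suc (≡.trans (≡.cong suc (double≡n+n n)) (≡.sym (ℕₚ.+-suc n n)))

triangle : ℕ → ℕ
triangle zero    = zero
triangle (suc n) = suc n ℕ.+ triangle n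

-- Identifies `(q ^ suc (double n)) ^ suc n`, which appears on the diagonal in `W-ψ`, as a power
-- with triangular exponent.
triangle-odd : ∀ n → triangle (suc (double n)) ≡ suc (double n) ℕ.* suc n
triangle-odd zero    = ≡.refl
triangle-odd (suc n) = ≡.trans (≡.cong (λ t → 3 ℕ.+ double n ℕ.+ (2 ℕ.+ double n ℕ.+ t)) (triangle-odd n))
  (≡.subst (λ d → 3 ℕ.+ d ℕ.+ (2 ℕ.+ d ℕ.+ suc d ℕ.* suc n) ≡ (3 ℕ.+ d) ℕ.* (2 ℕ.+ n))
    (≡.sym (double≡n+n n)) (lemma n))
  where
  lemma : ∀ n → 3 ℕ.+ (n ℕ.+ n) ℕ.+ (2 ℕ.+ (n ℕ.+ n) ℕ.+ (1 ℕ.+ (n ℕ.+ n)) ℕ.* (1 ℕ.+ n))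
              ≡ (3 ℕ.+ (n ℕ.+ n)) ℕ.* (2 ℕ.+ n)
  lemma = solve-∀

module ThetaIdentities {c ℓ : Level} (R : CommutativeRing c ℓ) where
  open CommutativeRing R
  open IntegerCoefficients R using (solve; _:=_; _:+_; _:*_; _:-_; :-_; con)
  open import Algebra.Properties.Ring ring using (-0#≈0#)
  open import Algebra.Properties.CommutativeSemiring.Exp commutativeSemiring
    using (_^_; ^-congˡ; ^-congʳ; ^-homo-*; ^-assocʳ; ^-distrib-*)
  open import Relation.Binary.Reasoning.Setoid setoid

  sign : ℕ → Carrier
  sign n = (- 1#) ^ n

  qfactorial : Carrier → ℕ → Carrier
  qfactorial x zero    = 1#
  qfactorial x (suc n) = (1# - x ^ suc n) * qfactorial x n

  -- coeff n = ∏_{i<n} (β - α bⁱ) and W n z = Σ_{s≤n} (∏_{s<i≤n} (1 - bⁱ)) (coeff s) zˢ, a truncation of Fine's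
  -- series.  W-shift is its q-difference equation in z.
  module FineSum (α β b : Carrier) where

    coeff : ℕ → Carrier
    coeff zero    = 1#
    coeff (suc n) = coeff n * (β - α * b ^ n)

    W : ℕ → Carrier → Carrier
    W zero    z = 1#
    W (suc n) z = (1# - b ^ suc n) * W n z + coeff (suc n) * z ^ suc n

    W-cong : ∀ n {y z} → y ≈ z → W n y ≈ W n z
    W-cong zero    y≈z = refl
    W-cong (suc n) y≈z = +-cong (*-congˡ (W-cong n y≈z)) (*-congˡ (^-congˡ (suc n) y≈z))

    W-shift : ∀ n z → (1# - α * z) * W n (b * z) ≈ (1# - β * z) * W n z + coeff (suc n) * z ^ suc n
    W-shift zero z = solve 3 (λ a e z →
      (con (+ 1) :- a :* z) :* con (+ 1) :=
      (con (+ 1) :- e :* z) :* con (+ 1) :+ (con (+ 1) :* (e :- a :* con (+ 1))) :* (z :* con (+ 1)))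
      refl α β z
    W-shift (suc n) z = begin
      (1# - α * z) * ((1# - B) * W n (b * z) + C * (b * z) ^ suc n)
        ≈⟨ *-congˡ (+-congˡ (*-congˡ (^-distrib-* b z (suc n)))) ⟩
      (1# - α * z) * ((1# - B) * W n (b * z) + C * (B * Z))
        ≈⟨ solve 6 (λ a z B w C Z →
             (con (+ 1) :- a :* z) :* ((con (+ 1) :- B) :* w :+ C :* (B :* Z)) :=
             (con (+ 1) :- B) :* ((con (+ 1) :- a :* z) :* w) :+ (con (+ 1) :- a :* z) :* (C :* (B :* Z)))
             refl α z B (W n (b * z)) C Z ⟩
      (1# - B) * ((1# - α * z) * W n (b * z)) + (1# - α * z) * (C * (B * Z))
        ≈⟨ +-congʳ (*-congˡ (W-shift n z)) ⟩
      (1# - B) * ((1# - β * z) * W n z + C * Z) + (1# - α * z) * (C * (B * Z))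
        -- Apart from the multiple of `w`, both sides equal CZ - αzCBZ.
        ≈⟨ solve 7 (λ a e z B w C Z →
             (con (+ 1) :- B) :* ((con (+ 1) :- e :* z) :* w :+ C :* Z) :+ (con (+ 1) :- a :* z) :* (C :* (B :* Z)) :=
             (con (+ 1) :- e :* z) :* ((con (+ 1) :- B) :* w :+ C :* Z) :+ (C :* (e :- a :* B)) :* (z :* Z))
             refl α β z B (W n z) C Z ⟩
      (1# - β * z) * ((1# - B) * W n z + C * Z) + (C * (β - α * B)) * (z * Z) ∎
      where
      B C Z : Carrier
      B = b ^ suc n
      C = coeff (suc n)
      Z = z ^ suc n

    -- The factor 1 - αz of `W-shift` is here the factor 1 - b^(n+1) in the recursion of `W`, so the
    -- q-difference equation becomes a recurrence from (n, z) to (n + 1, bz).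
    W-diagonal : ∀ n z → α * z ≈ b ^ suc n →
      W (suc n) (b * z) ≈ (1# - β * z) * W n z + coeff (suc n) * z ^ suc n * (1# + b ^ suc n)
    W-diagonal n z αz≈B = begin
      (1# - B) * W n (b * z) + C * (b * z) ^ suc n
        ≈⟨ +-cong (*-congʳ (+-congˡ (-‿cong (sym αz≈B)))) (*-congˡ (^-distrib-* b z (suc n))) ⟩
      (1# - α * z) * W n (b * z) + C * (B * Z)
        ≈⟨ +-congʳ (W-shift n z) ⟩
      ((1# - β * z) * W n z + C * Z) + C * (B * Z)
        ≈⟨ solve 4 (λ w C Z B → (w :+ C :* Z) :+ C :* (B :* Z) := w :+ C :* Z :* (con (+ 1) :+ B))
             refl ((1# - β * z) * W n z) C Z B ⟩
      (1# - β * z) * W n z + C * Z * (1# + B) ∎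
      where
      B C Z : Carrier
      B = b ^ suc n
      C = coeff (suc n)
      Z = z ^ suc n

    -- β - α is the factor i = 0 of every coefficient after the first.
    coeff-annihilated : ∀ {z} → z * (β - α) ≈ 0# → ∀ n → z * coeff (suc n) ≈ 0#
    coeff-annihilated {z} h zero    = trans (solve 3 (λ a e z →
      z :* (con (+ 1) :* (e :- a :* con (+ 1))) := z :* (e :- a)) refl α β z) h
    coeff-annihilated {z} h (suc n) =
      trans (sym (*-assoc _ _ _)) (trans (*-congʳ (coeff-annihilated h n)) (zeroˡ _))

    -- Every term with s ≥ 1 vanishes and the term s = 0 is the product. This plays the part of the
    -- limit z → 0.
    W-limit : ∀ {z} → z * (β - α) ≈ 0# → ∀ n → W n z ≈ qfactorial b n
    W-limit h zero    = refl
    W-limit {z} h (suc n) = begin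
      (1# - b ^ suc n) * W n z + coeff (suc n) * (z * z ^ n)
        ≈⟨ +-cong (*-congˡ (W-limit h n)) (solve 3 (λ C z Z → C :* (z :* Z) := z :* C :* Z) refl (coeff (suc n)) z (z ^ n)) ⟩
      qfactorial b (suc n) + z * coeff (suc n) * z ^ n
        ≈⟨ +-congˡ (trans (*-congʳ (coeff-annihilated h n)) (zeroˡ _)) ⟩
      qfactorial b (suc n) + 0#
        ≈⟨ +-identityʳ _ ⟩
      qfactorial b (suc n) ∎

  -- The diagonal z = xⁿ satisfies the hypothesis of W-diagonal for (α, β, b) = (x, 0, x); further down,
  -- z = qⁿ⁺¹ does for (1, -1, q), and z = q²ⁿ⁺¹ for (q, 1, q²).
  module _ (x : Carrier) where
    open FineSum x 0# x

    -- With m = n + 1 the exponents are m(3m - 1)/2 and m(3m + 1)/2, in the shape the diagonal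
    -- produces: `triangle m` from `coeff`, the rest from powers of z = xⁿ.
    pentagonalSum : ℕ → Carrier
    pentagonalSum zero    = 1#
    pentagonalSum (suc n) = pentagonalSum n
      + sign (suc n) * (x ^ (triangle (suc n) ℕ.+ n ℕ.* suc n) + x ^ (triangle (suc n) ℕ.+ suc n ℕ.* suc n))

    coeff-euler : ∀ n → coeff n ≈ sign n * x ^ triangle n
    coeff-euler zero    = sym (*-identityˡ 1#)
    coeff-euler (suc n) = begin
      coeff n * (0# - x ^ suc n)
        ≈⟨ *-congʳ (coeff-euler n) ⟩
      sign n * x ^ triangle n * (0# - x ^ suc n)
        ≈⟨ solve 3 (λ s t y → s :* t :* (con (+ 0) :- y) := (:- con (+ 1) :* s) :* (y :* t))
             refl (sign n) (x ^ triangle n) (x ^ suc n) ⟩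
      sign (suc n) * (x ^ suc n * x ^ triangle n)
        ≈⟨ *-congˡ (^-homo-* x (suc n) (triangle n)) ⟨
      sign (suc n) * x ^ triangle (suc n) ∎

    W-euler : ∀ n → W n (x ^ n) ≈ pentagonalSum n
    W-euler zero    = refl
    W-euler (suc n) = begin
      W (suc n) (x * x ^ n)
        ≈⟨ W-diagonal n (x ^ n) refl ⟩
      (1# - 0# * x ^ n) * W n (x ^ n) + coeff (suc n) * (x ^ n) ^ suc n * (1# + x ^ suc n)
        ≈⟨ +-cong (*-congˡ (W-euler n)) (*-congʳ (*-cong (coeff-euler (suc n)) (^-assocʳ x n (suc n)))) ⟩
      (1# - 0# * x ^ n) * pentagonalSum n + s * t * u * (1# + x ^ suc n)
        ≈⟨ solve 6 (λ y P s t u v →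
             (con (+ 1) :- con (+ 0) :* y) :* P :+ s :* t :* u :* (con (+ 1) :+ v) :=
             P :+ s :* (t :* u :+ t :* (v :* u))) refl (x ^ n) (pentagonalSum n) s t u (x ^ suc n) ⟩
      pentagonalSum n + s * (t * u + t * (x ^ suc n * u))
        ≈⟨ +-congˡ (*-congˡ (+-cong (sym (^-homo-* x (triangle (suc n)) (n ℕ.* suc n)))
             (trans (*-congˡ (sym (^-homo-* x (suc n) (n ℕ.* suc n)))) (sym (^-homo-* x (triangle (suc n)) (suc n ℕ.* suc n)))))) ⟩
      pentagonalSum (suc n) ∎
      where
      s t u : Carrier
      s = sign (suc n)
      t = x ^ triangle (suc n)
      u = x ^ (n ℕ.* suc n)

    -- Here β - α = -x, so at z = xⁿ the hypothesis of `W-limit` is the nilpotency of x.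
    euler : ∀ n → x ^ suc n ≈ 0# → qfactorial x n ≈ pentagonalSum n
    euler n nil = trans (sym (W-limit (trans (solve 2 (λ x y → y :* (con (+ 0) :- x) := :- (x :* y)) refl x (x ^ n))
      (trans (-‿cong nil) -0#≈0#)) n)) (W-euler n)

  module _ (q : Carrier) where

    plusFactorial : ℕ → Carrier
    plusFactorial zero    = 1#
    plusFactorial (suc n) = (1# + q ^ suc n) * plusFactorial n

    qfactorial*plusFactorial : ∀ n → qfactorial q n * plusFactorial n ≈ qfactorial (q * q) n
    qfactorial*plusFactorial zero    = *-identityˡ 1#
    qfactorial*plusFactorial (suc n) = begin
      (1# - Q) * qfactorial q n * ((1# + Q) * plusFactorial n)
        ≈⟨ solve 3 (λ Q f E → (con (+ 1) :- Q) :* f :* ((con (+ 1) :+ Q) :* E) := (con (+ 1) :- Q :* Q) :* (f :* E))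
             refl Q (qfactorial q n) (plusFactorial n) ⟩
      (1# - Q * Q) * (qfactorial q n * plusFactorial n)
        ≈⟨ *-cong (+-congˡ (-‿cong (sym (^-distrib-* q q (suc n))))) (qfactorial*plusFactorial n) ⟩
      qfactorial (q * q) (suc n) ∎
      where
      Q : Carrier
      Q = q ^ suc n

    squareSum : ℕ → Carrier
    squareSum zero    = 0#
    squareSum (suc n) = squareSum n + sign (suc n) * q ^ (suc n ℕ.* suc n)

    φ : ℕ → Carrier
    φ n = 1# + (squareSum n + squareSum n)

    module _ where
      open FineSum 1# (- 1#) q

      -- The factor i = 0 is -1 - 1 = -2: this is the source of the 2 in φ = 1 + 2X, and so of the
      -- modulus 4.
      coeff-φ : ∀ n → coeff (suc n) ≈ sign (suc n) * (plusFactorial n + plusFactorial n)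
      coeff-φ zero    = solve 0 (con (+ 1) :* (:- con (+ 1) :- con (+ 1) :* con (+ 1)) :=
        (:- con (+ 1) :* con (+ 1)) :* (con (+ 1) :+ con (+ 1))) refl
      coeff-φ (suc n) = trans (*-congʳ (coeff-φ n)) (solve 3 (λ s E Q →
        s :* (E :+ E) :* (:- con (+ 1) :- con (+ 1) :* Q) :=
        (:- con (+ 1) :* s) :* ((con (+ 1) :+ Q) :* E :+ (con (+ 1) :+ Q) :* E))
        refl (sign (suc n)) (plusFactorial n) (q ^ suc n))

      W-φ : ∀ n → W n (q ^ suc n) ≈ plusFactorial n * φ n
      W-φ zero    = solve 0 (con (+ 1) := con (+ 1) :* (con (+ 1) :+ (con (+ 0) :+ con (+ 0)))) refl
      W-φ (suc n) = begin
        W (suc n) (q * Q)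
          ≈⟨ W-diagonal n Q (*-identityˡ _) ⟩
        (1# - - 1# * Q) * W n Q + coeff (suc n) * Q ^ suc n * (1# + Q)
          ≈⟨ +-cong (*-congˡ (W-φ n)) (*-congʳ (*-cong (coeff-φ n) (^-assocʳ q (suc n) (suc n)))) ⟩
        (1# - - 1# * Q) * (E * φ n) + s * (E + E) * u * (1# + Q)
          ≈⟨ solve 5 (λ Q E X s u →
               (con (+ 1) :- :- con (+ 1) :* Q) :* (E :* (con (+ 1) :+ (X :+ X))) :+ s :* (E :+ E) :* u :* (con (+ 1) :+ Q) :=
               (con (+ 1) :+ Q) :* E :* (con (+ 1) :+ ((X :+ s :* u) :+ (X :+ s :* u))))
               refl Q E (squareSum n) s u ⟩
        plusFactorial (suc n) * φ (suc n) ∎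
        where
        Q E s u : Carrier
        Q = q ^ suc n
        E = plusFactorial n
        s = sign (suc n)
        u = q ^ (suc n ℕ.* suc n)

      gauss-φ : ∀ n → q ^ suc n ≈ 0# → qfactorial q n ≈ plusFactorial n * φ n
      gauss-φ n nil = trans (sym (W-limit (trans (*-congʳ nil) (zeroˡ _)) n)) (W-φ n)

    ψ : ℕ → Carrier
    ψ zero    = 1#
    ψ (suc n) = ψ n + q ^ triangle (suc n)

    ^-double : ∀ n → q ^ double n ≈ (q * q) ^ n
    ^-double zero    = refl
    ^-double (suc n) = trans (sym (*-assoc _ _ _)) (*-congˡ (^-double n))

    module _ where
      open FineSum q 1# (q * q)

      -- With these parameters `coeff n` is the product of 1 - q^(2i+1) over i < n, so the factors
      -- are sorted by the parity of their exponents.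
      coeff-split : ∀ n → qfactorial q (double n) ≈ qfactorial (q * q) n * coeff n
      coeff-split zero    = sym (*-identityˡ 1#)
      coeff-split (suc n) = begin
        (1# - q ^ double (suc n)) * ((1# - q * q ^ double n) * qfactorial q (double n))
          ≈⟨ *-cong (+-congˡ (-‿cong (^-double (suc n))))
               (*-cong (+-congˡ (-‿cong (*-congˡ (^-double n)))) (coeff-split n)) ⟩
        (1# - (q * q) ^ suc n) * ((1# - q * (q * q) ^ n) * (qfactorial (q * q) n * coeff n))
          ≈⟨ solve 4 (λ a b d c → a :* (b :* (d :* c)) := a :* d :* (c :* b)) refl _ _ _ _ ⟩
        qfactorial (q * q) (suc n) * coeff (suc n) ∎

      -- The factor 1 + b^(n+1) = 1 + q^(2n+2) splits each diagonal step into two consecutive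
      -- triangular terms, of indices 2n + 1 and 2n + 2.
      W-ψ : ∀ n → W n (q ^ suc (double n)) ≈ coeff n * ψ (double n)
      W-ψ zero    = sym (*-identityˡ 1#)
      W-ψ (suc n) = begin
        W (suc n) (q * (q * z))
          ≈⟨ W-cong (suc n) (sym (*-assoc _ _ _)) ⟩
        W (suc n) (q * q * z)
          ≈⟨ W-diagonal n z (^-double (suc n)) ⟩
        (1# - 1# * z) * W n z + coeff (suc n) * z ^ suc n * (1# + (q * q) ^ suc n)
          ≈⟨ +-cong (*-cong (+-congˡ (-‿cong (trans (*-identityˡ z) (*-congˡ (^-double n))))) (W-ψ n))
               (*-cong (*-congˡ z^≈t) (+-congˡ (sym (^-double (suc n))))) ⟩
        (1# - q * (q * q) ^ n) * (coeff n * ψ (double n)) + coeff (suc n) * t * (1# + u)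
          ≈⟨ solve 5 (λ y c p t u →
               y :* (c :* p) :+ (c :* y) :* t :* (con (+ 1) :+ u) := (c :* y) :* (p :+ t :+ u :* t))
               refl (1# - q * (q * q) ^ n) (coeff n) (ψ (double n)) t u ⟩
        coeff (suc n) * (ψ (double n) + t + u * t)
          ≈⟨ *-congˡ (+-congˡ (sym (^-homo-* q (double (suc n)) (triangle (suc (double n)))))) ⟩
        coeff (suc n) * ψ (double (suc n)) ∎
        where
        z t u : Carrier
        z = q ^ suc (double n)
        t = q ^ triangle (suc (double n))
        u = q ^ double (suc n)
        z^≈t : z ^ suc n ≈ t
        z^≈t = trans (^-assocʳ q (suc (double n)) (suc n)) (^-congʳ q (≡.sym (triangle-odd n)))

    module _ (N : ℕ) (nil : q ^ suc N ≈ 0#) where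

      vanish : ∀ k → q ^ (k ℕ.+ suc N) ≈ 0#
      vanish k = trans (^-homo-* q k (suc N)) (trans (*-congˡ nil) (zeroʳ _))

      vanish-multiple : ∀ k → (q ^ suc k) ^ suc N ≈ 0#
      vanish-multiple k = trans (^-assocʳ q (suc k) (suc N))
        (trans (^-congʳ q (ℕₚ.+-comm (suc N) (k ℕ.* suc N))) (vanish (k ℕ.* suc N)))

      gauss-ψ : qfactorial (q * q) N ≈ FineSum.coeff q 1# (q * q) N * ψ (double N)
      gauss-ψ = trans (sym (FineSum.W-limit q 1# (q * q) (trans (*-congʳ zero′) (zeroˡ _)) N)) (W-ψ N)
        where
        zero′ : q ^ suc (double N) ≈ 0#
        zero′ = trans (^-congʳ q (≡.trans (≡.cong suc (double≡n+n N)) (≡.sym (ℕₚ.+-suc N N)))) (vanish N)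

      qfactorial-stable : ∀ k → qfactorial q (k ℕ.+ N) ≈ qfactorial q N
      qfactorial-stable zero    = refl
      qfactorial-stable (suc k) = begin
        (1# - q ^ suc (k ℕ.+ N)) * qfactorial q (k ℕ.+ N)
          ≈⟨ *-cong (+-congˡ (-‿cong (trans (^-congʳ q (≡.sym (ℕₚ.+-suc k N))) (vanish k)))) (qfactorial-stable k) ⟩
        (1# - 0#) * qfactorial q N
          ≈⟨ solve 1 (λ f → (con (+ 1) :- con (+ 0)) :* f := f) refl _ ⟩
        qfactorial q N ∎

      qfactorial-double : qfactorial q (double N) ≈ qfactorial q N
      qfactorial-double = trans (reflexive (≡.cong (qfactorial q) (double≡n+n N))) (qfactorial-stable N)

      -- The hypothesis says x = Qx with Q nilpotent; iterating it gives x = Q^(N+1) x = 0.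
      factor-cancel : ∀ k x → (1# - q ^ suc k) * x ≈ 0# → x ≈ 0#
      factor-cancel k x h = trans (power (suc N)) (trans (*-congʳ (vanish-multiple k)) (zeroˡ _))
        where
        Q : Carrier
        Q = q ^ suc k
        step : x ≈ Q * x
        step = begin
          x                       ≈⟨ solve 2 (λ Q x → x := (con (+ 1) :- Q) :* x :+ Q :* x) refl Q x ⟩
          (1# - Q) * x + Q * x    ≈⟨ +-congʳ h ⟩
          0# + Q * x              ≈⟨ +-identityˡ _ ⟩
          Q * x                   ∎
        power : ∀ n → x ≈ Q ^ n * x
        power zero    = sym (*-identityˡ x)
        power (suc n) = trans step (trans (*-congˡ (power n)) (sym (*-assoc _ _ _)))

      qfactorial-cancel : ∀ n x → qfactorial q n * x ≈ 0# → x ≈ 0#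
      qfactorial-cancel zero    x h = trans (sym (*-identityˡ x)) h
      qfactorial-cancel (suc n) x h =
        qfactorial-cancel n x (factor-cancel n _ (trans (sym (*-assoc _ _ _)) h))

      f D : Carrier
      f = qfactorial q N
      D = qfactorial (q * q) N

      f²≈Dφ : f * f ≈ D * φ N
      f²≈Dφ = begin
        f * f                         ≈⟨ *-congˡ (gauss-φ N nil) ⟩
        f * (plusFactorial N * φ N)   ≈⟨ *-assoc _ _ _ ⟨
        f * plusFactorial N * φ N     ≈⟨ *-congʳ (qfactorial*plusFactorial N) ⟩
        D * φ N                       ∎

      -- With O the product over odd exponents, f = DO by parity and D = Oψ by Gauss.
      ψf≈D² : ψ (double N) * f ≈ D * D
      ψf≈D² = begin
        ψ (double N) * f        ≈⟨ *-congˡ qfactorial-double ⟨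
        ψ (double N) * qfactorial q (double N)  ≈⟨ *-congˡ (coeff-split N) ⟩
        ψ (double N) * (D * O)  ≈⟨ solve 3 (λ p D O → p :* (D :* O) := D :* (O :* p)) refl _ _ _ ⟩
        D * (O * ψ (double N))  ≈⟨ *-congˡ gauss-ψ ⟨
        D * D                   ∎
        where
        O : Carrier
        O = FineSum.coeff q 1# (q * q) N

      -- As φ = 1 + 2X, squaring f² = Dφ gives f⁴ = D²(1 + 4(X + X²)) with D² = ψf = Sf².
      S≈f²-mod-4 : ∀ S → S * f ≈ ψ (double N) → ∃ λ Y → S ≈ f * f - (Y + Y + (Y + Y))
      -- With V = X + X², f⁴ = Sf²(1 + 4V); cancelling f² gives f² = S + 4SV, hence the witness SV.
      S≈f²-mod-4 S Sf≈ψ = S * V , trans (solve 3 (λ S V g → S :=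
          g :- (S :* V :+ S :* V :+ (S :* V :+ S :* V)) :+
          ((S :+ (S :* V :+ S :* V :+ (S :* V :+ S :* V))) :- g)) refl S V (f * f))
          (trans (+-congˡ difference≈0) (+-identityʳ _))
        where
        X V : Carrier
        X = squareSum N
        V = X + X * X

        Sf²≈D² : S * f * f ≈ D * D
        Sf²≈D² = trans (*-congʳ Sf≈ψ) ψf≈D²

        f²*difference≈0 : f * (f * ((S + (S * V + S * V + (S * V + S * V))) - f * f)) ≈ 0#
        f²*difference≈0 = begin
          f * (f * ((S + (S * V + S * V + (S * V + S * V))) - f * f))
            ≈⟨ solve 3 (λ f S V → f :* (f :* ((S :+ (S :* V :+ S :* V :+ (S :* V :+ S :* V))) :- f :* f)) :=
                 S :* f :* f :* (con (+ 1) :+ con (+ 4) :* V) :- (f :* f) :* (f :* f)) refl f S V ⟩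
          S * f * f * (1# + _ * V) - (f * f) * (f * f)
            ≈⟨ +-cong (*-congʳ Sf²≈D²) (-‿cong (*-cong f²≈Dφ f²≈Dφ)) ⟩
          D * D * (1# + _ * V) - (D * φ N) * (D * φ N)
            ≈⟨ solve 2 (λ D X → D :* D :* (con (+ 1) :+ con (+ 4) :* (X :+ X :* X))
                 :- (D :* (con (+ 1) :+ (X :+ X))) :* (D :* (con (+ 1) :+ (X :+ X))) := con (+ 0)) refl D X ⟩
          0# ∎

        difference≈0 : (S + (S * V + S * V + (S * V + S * V))) - f * f ≈ 0#
        difference≈0 = qfactorial-cancel N _ (qfactorial-cancel N _ f²*difference≈0)

open import Data.Product using (_×_)
open import Data.Empty using (⊥; ⊥-elim)
open ≡ using (refl; sym; trans; cong; cong₂; subst)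

-- Exponents of theta series

Sumset : (E E′ : ℕ → Set) → ℕ → Set
Sumset E E′ n = ∃₂ λ e e′ → E e × E′ e′ × e ℕ.+ e′ ≡ n

-- 24 · m(3m ± 1)/2 + 1 = (6m ± 1)²
Pentagonal : ℕ → Set
Pentagonal e = ∃ λ a → a ℕ.* a ≡ suc (24 ℕ.* e)

-- For e = 2g the pentagonal condition on g reads 12e + 1 = a². Conversely such an a is prime to 6,
-- so a² is 1 modulo 24 and e is even.
DoublePentagonal : ℕ → Set
DoublePentagonal e = ∃ λ a → a ℕ.* a ≡ suc (12 ℕ.* e)

PerfectSquare : ℕ → Set
PerfectSquare e = ∃ λ a → a ℕ.* a ≡ e

2*triangle : ∀ n → 2 ℕ.* triangle n ≡ n ℕ.* suc n
2*triangle zero    = refl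
2*triangle (suc n) = trans (ℕₚ.*-distribˡ-+ 2 (suc n) (triangle n))
  (trans (cong (2 ℕ.* suc n ℕ.+_) (2*triangle n)) (lemma n))
  where
  lemma : ∀ n → 2 ℕ.* suc n ℕ.+ n ℕ.* suc n ≡ suc n ℕ.* suc (suc n)
  lemma = solve-∀

24*[triangle+k] : ∀ k n → suc (24 ℕ.* (triangle n ℕ.+ k)) ≡ suc (12 ℕ.* (n ℕ.* suc n) ℕ.+ 24 ℕ.* k)
24*[triangle+k] k n = trans (lemma (triangle n) k) (cong (λ t → suc (12 ℕ.* t ℕ.+ 24 ℕ.* k)) (2*triangle n))
  where
  lemma : ∀ t k → suc (24 ℕ.* (t ℕ.+ k)) ≡ suc (12 ℕ.* (2 ℕ.* t) ℕ.+ 24 ℕ.* k)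
  lemma = solve-∀

pentagonal⁻ : ∀ n → Pentagonal (triangle (suc n) ℕ.+ n ℕ.* suc n)
-- The root is 6m - 1 for m = n + 1; in `pentagonal⁺` it is 6m + 1.
pentagonal⁻ n = 6 ℕ.* n ℕ.+ 5 , trans (lemma n) (sym (24*[triangle+k] (n ℕ.* suc n) (suc n)))
  where
  lemma : ∀ n → (6 ℕ.* n ℕ.+ 5) ℕ.* (6 ℕ.* n ℕ.+ 5) ≡ suc (12 ℕ.* (suc n ℕ.* suc (suc n)) ℕ.+ 24 ℕ.* (n ℕ.* suc n))
  lemma = solve-∀

pentagonal⁺ : ∀ n → Pentagonal (triangle (suc n) ℕ.+ suc n ℕ.* suc n)
pentagonal⁺ n = 6 ℕ.* n ℕ.+ 7 , trans (lemma n) (sym (24*[triangle+k] (suc n ℕ.* suc n) (suc n)))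
  where
  lemma : ∀ n → (6 ℕ.* n ℕ.+ 7) ℕ.* (6 ℕ.* n ℕ.+ 7) ≡ suc (12 ℕ.* (suc n ℕ.* suc (suc n)) ℕ.+ 24 ℕ.* (suc n ℕ.* suc n))
  lemma = solve-∀

module Supports {c ℓ : Level} (R : CommutativeRing c ℓ) (q : CommutativeRing.Carrier R) where
  open CommutativeRing R renaming (refl to ≈-refl; sym to ≈-sym; trans to ≈-trans)
  open import Algebra.Properties.Ring ring using (-‿distribˡ-*; -‿distribʳ-*; -1*x≈-x)
  open import Algebra.Properties.CommutativeSemiring.Exp commutativeSemiring using (_^_; ^-homo-*; ^-congʳ)
  open ThetaIdentities R

  -- Elements of an abstract ring have no coefficients to inspect, so the support is bounded by a
  -- derivation: the additive group generated by the monomials with exponent in `E`, closed under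
  -- the equality of the ring.
  data Span (E : ℕ → Set) : Carrier → Set (c ⊔ ℓ) where
    monomial : ∀ {e} → E e → Span E (q ^ e)
    null     : Span E 0#
    add      : ∀ {x y} → Span E x → Span E y → Span E (x + y)
    negate   : ∀ {x} → Span E x → Span E (- x)
    resp     : ∀ {x y} → x ≈ y → Span E x → Span E y

  span-monomial-* : ∀ {E E′ e} → E e → ∀ {y} → Span E′ y → Span (Sumset E E′) (q ^ e * y)
  span-monomial-* {e = e} p (monomial {e′} p′) = resp (^-homo-* q e e′) (monomial (e , e′ , p , p′ , refl))
  span-monomial-* p null         = resp (≈-sym (zeroʳ _)) null
  span-monomial-* p (add s t)    = resp (≈-sym (distribˡ _ _ _)) (add (span-monomial-* p s) (span-monomial-* p t))
  span-monomial-* p (negate s)   = resp (-‿distribʳ-* _ _) (negate (span-monomial-* p s))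
  span-monomial-* p (resp x≈y s) = resp (*-congˡ x≈y) (span-monomial-* p s)

  span-* : ∀ {E E′ x y} → Span E x → Span E′ y → Span (Sumset E E′) (x * y)
  span-* (monomial p)   t = span-monomial-* p t
  span-* null           t = resp (≈-sym (zeroˡ _)) null
  span-* (add s s′)     t = resp (≈-sym (distribʳ _ _ _)) (add (span-* s t) (span-* s′ t))
  span-* (negate s)     t = resp (-‿distribˡ-* _ _) (negate (span-* s t))
  span-* (resp x≈y s)   t = resp (*-congʳ x≈y) (span-* s t)

  span-sign : ∀ {E x} n → Span E x → Span E (sign n * x)
  span-sign zero    s = resp (≈-sym (*-identityˡ _)) s
  span-sign (suc n) s = resp (≈-trans (≈-sym (-1*x≈-x _)) (≈-sym (*-assoc _ _ _))) (negate (span-sign n s))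

  -- The base x is kept general to serve both f, with x = q, and D, with x = q².
  span-pentagonalSum : ∀ {E} x → (∀ e → Pentagonal e → Span E (x ^ e)) → ∀ n → Span E (pentagonalSum x n)
  span-pentagonalSum x h zero    = h 0 (1 , refl)
  span-pentagonalSum x h (suc n) = add (span-pentagonalSum x h n)
    (span-sign (suc n) (add
      (h (triangle (suc n) ℕ.+ n ℕ.* suc n) (pentagonal⁻ n))
      (h (triangle (suc n) ℕ.+ suc n ℕ.* suc n) (pentagonal⁺ n))))

  span-φ : ∀ n → Span PerfectSquare (φ q n)
  span-φ n = add (monomial {e = 0} (0 , refl)) (add (squares n) (squares n))
    where
    squares : ∀ n → Span PerfectSquare (squareSum q n)
    squares zero    = null
    squares (suc n) = add (squares n) (span-sign (suc n) (monomial (suc n , refl)))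

-- Formal power series over ℤ and their truncations

Series : Set
Series = ℕ → ℤ

infixl 7 _⊛_
infixl 6 _⊕_

_⊕_ _⊛_ : Series → Series → Series
(f ⊕ g) n = f n ℤ.+ g n
(f ⊛ g) zero    = f 0 ℤ.* g 0
(f ⊛ g) (suc n) = f 0 ℤ.* g (suc n) ℤ.+ (f ∘ suc ⊛ g) n

⊖_ : Series → Series
(⊖ f) n = ℤ.- f n

𝟘 𝟙 𝕢 : Series
𝟘 _ = 0ℤ
𝟙 zero    = 1ℤ
𝟙 (suc _) = 0ℤ
𝕢 zero    = 0ℤ
𝕢 (suc n) = 𝟙 n

-- Makes multiplication respect equality in degrees at most N.
⊛-cong-≤ : ∀ n {f f′ g g′ : Series} → (∀ k → k ℕ.≤ n → f k ≡ f′ k) → (∀ k → k ℕ.≤ n → g k ≡ g′ k) →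
  (f ⊛ g) n ≡ (f′ ⊛ g′) n
⊛-cong-≤ zero    f≡ g≡ = cong₂ ℤ._*_ (f≡ 0 z≤n) (g≡ 0 z≤n)
⊛-cong-≤ (suc n) f≡ g≡ = cong₂ ℤ._+_ (cong₂ ℤ._*_ (f≡ 0 z≤n) (g≡ (suc n) ℕₚ.≤-refl))
  (⊛-cong-≤ n (λ k k≤n → f≡ (suc k) (s≤s k≤n)) (λ k k≤n → g≡ k (ℕₚ.m≤n⇒m≤1+n k≤n)))

⊛-zeroˡ : ∀ f n → (𝟘 ⊛ f) n ≡ 0ℤ
⊛-zeroˡ f zero    = refl
⊛-zeroˡ f (suc n) = trans (ℤₚ.+-identityˡ _) (⊛-zeroˡ f n)

⊛-identityˡ : ∀ f n → (𝟙 ⊛ f) n ≡ f n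
⊛-identityˡ f zero    = ℤₚ.*-identityˡ (f 0)
⊛-identityˡ f (suc n) = trans (cong₂ ℤ._+_ (ℤₚ.*-identityˡ (f (suc n))) (⊛-zeroˡ f n)) (ℤₚ.+-identityʳ (f (suc n)))

⊛-distribʳ : ∀ h f g n → ((f ⊕ g) ⊛ h) n ≡ (f ⊛ h ⊕ g ⊛ h) n
⊛-distribʳ h f g zero    = ℤₚ.*-distribʳ-+ (h 0) (f 0) (g 0)
⊛-distribʳ h f g (suc n) = trans
  (cong (ℤ._+_ ((f 0 ℤ.+ g 0) ℤ.* h (suc n))) (⊛-distribʳ h (f ∘ suc) (g ∘ suc) n))
  (lemma (f 0) (g 0) (h (suc n)) _ _)
  where
  lemma : ∀ a b c x y → (a ℤ.+ b) ℤ.* c ℤ.+ (x ℤ.+ y) ≡ (a ℤ.* c ℤ.+ x) ℤ.+ (b ℤ.* c ℤ.+ y)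
  lemma = ℤ-Solver.solve-∀

⊛-scale : ∀ c f g n → ((λ k → c ℤ.* f k) ⊛ g) n ≡ c ℤ.* (f ⊛ g) n
⊛-scale c f g zero    = ℤₚ.*-assoc c _ _
⊛-scale c f g (suc n) = trans
  (cong (ℤ._+_ (c ℤ.* f 0 ℤ.* g (suc n))) (⊛-scale c (f ∘ suc) g n))
  (lemma c (f 0) (g (suc n)) _)
  where
  lemma : ∀ c a b x → c ℤ.* a ℤ.* b ℤ.+ c ℤ.* x ≡ c ℤ.* (a ℤ.* b ℤ.+ x)
  lemma = ℤ-Solver.solve-∀

-- The mirror image of the defining recursion, peeling the right factor; commutativity follows by
-- comparing the two.
⊛-suc : ∀ f g n → (f ⊛ g) (suc n) ≡ f (suc n) ℤ.* g 0 ℤ.+ (f ⊛ g ∘ suc) n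
⊛-suc f g zero    = ℤₚ.+-comm (f 0 ℤ.* g 1) (f 1 ℤ.* g 0)
⊛-suc f g (suc n) = trans (cong (ℤ._+_ (f 0 ℤ.* g (suc (suc n)))) (⊛-suc (f ∘ suc) g n))
  (lemma (f 0 ℤ.* g (suc (suc n))) (f (suc (suc n)) ℤ.* g 0) _)
  where
  lemma : ∀ a b x → a ℤ.+ (b ℤ.+ x) ≡ b ℤ.+ (a ℤ.+ x)
  lemma = ℤ-Solver.solve-∀

⊛-comm : ∀ f g n → (f ⊛ g) n ≡ (g ⊛ f) n
⊛-comm f g zero    = ℤₚ.*-comm (f 0) (g 0)
⊛-comm f g (suc n) = trans (cong₂ ℤ._+_ (ℤₚ.*-comm (f 0) (g (suc n))) (⊛-comm (f ∘ suc) g n))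
  (sym (⊛-suc g f n))

⊛-assoc : ∀ f g h n → ((f ⊛ g) ⊛ h) n ≡ (f ⊛ (g ⊛ h)) n
⊛-assoc f g h zero    = ℤₚ.*-assoc (f 0) (g 0) (h 0)
⊛-assoc f g h (suc n) = trans
  (cong (ℤ._+_ (f 0 ℤ.* g 0 ℤ.* h (suc n)))
    (trans (⊛-distribʳ h (λ k → f 0 ℤ.* g (suc k)) (f ∘ suc ⊛ g) n)
      (cong₂ ℤ._+_ (⊛-scale (f 0) (g ∘ suc) h n) (⊛-assoc (f ∘ suc) g h n))))
  (lemma (f 0) (g 0) (h (suc n)) _ _)
  where
  lemma : ∀ a b c x y → a ℤ.* b ℤ.* c ℤ.+ (a ℤ.* x ℤ.+ y) ≡ a ℤ.* (b ℤ.* c ℤ.+ x) ℤ.+ y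
  lemma = ℤ-Solver.solve-∀

-- ℤ[q]/(q^(N+1)), presented as series compared in degrees ≤ N.
truncated : ℕ → CommutativeRing 0ℓ 0ℓ
truncated N = record
  { Carrier = Series
  ; _≈_     = λ f g → ∀ n → n ℕ.≤ N → f n ≡ g n
  ; _+_     = _⊕_
  ; _*_     = _⊛_
  ; -_      = ⊖_
  ; 0#      = 𝟘
  ; 1#      = 𝟙
  ; isCommutativeRing = record
    { isRing = record
      { +-isAbelianGroup = record
        { isGroup = record
          { isMonoid = record
            { isSemigroup = record
              { isMagma = record
                { isEquivalence = record
                  { refl  = λ _ _ → refl
                  ; sym   = λ f≈g n n≤N → sym (f≈g n n≤N)
                  ; trans = λ f≈g g≈h n n≤N → trans (f≈g n n≤N) (g≈h n n≤N)
                  }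
                ; ∙-cong = λ f≈f′ g≈g′ n n≤N → cong₂ ℤ._+_ (f≈f′ n n≤N) (g≈g′ n n≤N)
                }
              ; assoc = λ f g h n _ → ℤₚ.+-assoc (f n) (g n) (h n)
              }
            ; identity = (λ f n _ → ℤₚ.+-identityˡ (f n)) , (λ f n _ → ℤₚ.+-identityʳ (f n))
            }
          ; inverse = (λ f n _ → ℤₚ.+-inverseˡ (f n)) , (λ f n _ → ℤₚ.+-inverseʳ (f n))
          ; ⁻¹-cong = λ f≈g n n≤N → cong ℤ.-_ (f≈g n n≤N)
          }
        ; comm = λ f g n _ → ℤₚ.+-comm (f n) (g n)
        }
      ; *-cong = λ f≈f′ g≈g′ n n≤N → ⊛-cong-≤ n
          (λ k k≤n → f≈f′ k (ℕₚ.≤-trans k≤n n≤N)) (λ k k≤n → g≈g′ k (ℕₚ.≤-trans k≤n n≤N))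
      ; *-assoc = λ f g h n _ → ⊛-assoc f g h n
      ; *-identity = (λ f n _ → ⊛-identityˡ f n) , (λ f n _ → trans (⊛-comm f 𝟙 n) (⊛-identityˡ f n))
      ; distrib = (λ f g h n _ → trans (⊛-comm f (g ⊕ h) n)
            (trans (⊛-distribʳ f g h n) (cong₂ ℤ._+_ (⊛-comm g f n) (⊛-comm h f n))))
          , (λ f g h n _ → ⊛-distribʳ f g h n)
      }
    ; *-comm = λ f g n _ → ⊛-comm f g n
    }
  }

module Truncated (N : ℕ) where
  open CommutativeRing (truncated N) using (_≈_; commutativeSemiring)
  open import Algebra.Properties.CommutativeSemiring.Exp commutativeSemiring using (_^_)
  open Supports (truncated N) 𝕢

  𝕢⊛-zero : ∀ f → (𝕢 ⊛ f) 0 ≡ 0ℤ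
  𝕢⊛-zero f = refl

  𝕢⊛-suc : ∀ f n → (𝕢 ⊛ f) (suc n) ≡ f n
  𝕢⊛-suc f n = trans (ℤₚ.+-identityˡ _) (⊛-identityˡ f n)

  𝕢^⊛-< : ∀ d f {n} → n ℕ.< d → (𝕢 ^ d ⊛ f) n ≡ 0ℤ
  𝕢^⊛-< (suc d) f {zero}  _         = trans (⊛-assoc 𝕢 (𝕢 ^ d) f 0) (𝕢⊛-zero (𝕢 ^ d ⊛ f))
  𝕢^⊛-< (suc d) f {suc n} (s≤s n<d) =
    trans (⊛-assoc 𝕢 (𝕢 ^ d) f (suc n)) (trans (𝕢⊛-suc (𝕢 ^ d ⊛ f) n) (𝕢^⊛-< d f n<d))

  𝕢^⊛-≥ : ∀ d f {n} → d ℕ.≤ n → (𝕢 ^ d ⊛ f) n ≡ f (n ℕ.∸ d)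
  𝕢^⊛-≥ zero    f _                 = ⊛-identityˡ f _
  𝕢^⊛-≥ (suc d) f {suc n} (s≤s d≤n) =
    trans (⊛-assoc 𝕢 (𝕢 ^ d) f (suc n)) (trans (𝕢⊛-suc (𝕢 ^ d ⊛ f) n) (𝕢^⊛-≥ d f d≤n))

  𝕢^-off : ∀ d n → d ≢ n → (𝕢 ^ d) n ≡ 0ℤ
  𝕢^-off zero    zero    d≢n = ⊥-elim (d≢n refl)
  𝕢^-off zero    (suc n) d≢n = refl
  𝕢^-off (suc d) zero    d≢n = 𝕢⊛-zero (𝕢 ^ d)
  𝕢^-off (suc d) (suc n) d≢n = trans (𝕢⊛-suc (𝕢 ^ d) n) (𝕢^-off d n (d≢n ∘ cong suc))

  𝕢-nilpotent : 𝕢 ^ suc N ≈ 𝟘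
  𝕢-nilpotent n n≤N = 𝕢^-off (suc N) n (λ { refl → ℕₚ.1+n≰n n≤N })

  span-coefficient : ∀ {E f} → Span E f → ¬ E N → f N ≡ 0ℤ
  span-coefficient (monomial {e} p) ¬E = 𝕢^-off e N (λ { refl → ¬E p })
  span-coefficient null             ¬E = refl
  span-coefficient (add s t)        ¬E = cong₂ ℤ._+_ (span-coefficient s ¬E) (span-coefficient t ¬E)
  span-coefficient (negate s)       ¬E = cong ℤ.-_ (span-coefficient s ¬E)
  span-coefficient (resp f≈g s)     ¬E = trans (sym (f≈g N ℕₚ.≤-refl)) (span-coefficient s ¬E)

open import Data.Nat using (_≤_; _<_; _+_; _*_; _∸_)
open import Data.Nat.Properties using (_≤?_; _≟_)
open import Data.Nat.Divisibility
open import Data.Nat.ListAction using (sum)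
open import Data.Nat.ListAction.Properties using (sum-++)
open import Data.Fin.Base as Fin using (Fin; toℕ)
import Data.Fin.Properties as Finₚ
open import Data.List.Base using (List; []; _∷_; map; concatMap; replicate; _++_; length; upTo; applyUpTo; lookup)
open import Data.List.Properties using (map-++; map-∘; map-cong-local; map-applyUpTo)
open import Data.List.Membership.Propositional using (_∈_; _∉_)
open import Data.List.Membership.Propositional.Properties using (∈-++⁺ʳ; ∈-++⁻)
open import Data.List.Membership.DecPropositional ℕₚ._≟_ using (_∈?_)
open import Data.List.Relation.Unary.All as All using (All; []; _∷_)
import Data.List.Relation.Unary.All.Properties as Allₚ
open import Data.List.Relation.Unary.Any using (here; there; index)
open import Data.List.Relation.Unary.Any.Properties using (lookup-index)
open import Data.Sum using (_⊎_; inj₁; inj₂; [_,_]′)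
open import Relation.Binary.Definitions using (tri<; tri≈; tri>)

-- The generating function of σmex

Filled : List ℕ → ℕ → Set
Filled xs k = ∀ i → 1 ≤ i → i < k → i ∈ xs

-- Determines the mex uniquely, so that mexes of different lists can be compared without reference
-- to the fuel.
record IsMex (xs : List ℕ) (k : ℕ) : Set where
  constructor isMex
  field
    positive : 1 ≤ k
    absent   : k ∉ xs
    filled   : Filled xs k

isMex-unique : ∀ {xs k l} → IsMex xs k → IsMex xs l → k ≡ l
isMex-unique {k = k} {l} (isMex 1≤k k∉ <k) (isMex 1≤l l∉ <l) with ℕₚ.<-cmp k l
... | tri< k<l _ _ = ⊥-elim (k∉ (<l k 1≤k k<l))
... | tri≈ _ k≡l _ = k≡l
... | tri> _ _ l<k = ⊥-elim (l∉ (<k l 1≤l l<k))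

-- Otherwise the numbers 1, ..., `length xs` + 1 would all occur, and two of them would share a
-- position.
filled⇒≤length : ∀ {xs k} → Filled xs k → k ≤ suc (length xs)
filled⇒≤length {xs} {k} h with k ≤? suc (length xs)
... | yes k≤ = k≤
... | no  k≰ with Finₚ.pigeonhole (ℕₚ.n<1+n (length xs)) (index ∘ mem)
  where
  mem : (i : Fin (suc (length xs))) → suc (toℕ i) ∈ xs
  mem i = h (suc (toℕ i)) (s≤s z≤n) (ℕₚ.≤-<-trans (Finₚ.toℕ<n i) (ℕₚ.≰⇒> k≰))
... | i , j , i<j , eq = ⊥-elim (ℕₚ.<⇒≢ i<j (ℕₚ.suc-injective
        (trans (lookup-index (h (suc (toℕ i)) _ _)) (trans (cong (lookup xs) eq) (sym (lookup-index (h (suc (toℕ j)) _ _)))))))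

filled-suc : ∀ {xs k} → k ∈ xs → Filled xs k → Filled xs (suc k)
filled-suc {k = k} k∈ h i 1≤i (s≤s i≤k) with ℕₚ.m≤n⇒m<n∨m≡n i≤k
... | inj₁ i<k  = h i 1≤i i<k
... | inj₂ refl = k∈

-- By the invariant on k + f, the fuel could run out only at k = `length xs` + 2, which
-- `filled⇒≤length` excludes.
mexFrom-isMex : ∀ f k xs → 1 ≤ k → Filled xs k → k + f ≡ suc (suc (length xs)) → IsMex xs (mexFrom f k xs)
mexFrom-isMex zero    k xs 1≤k h eq =
  ⊥-elim (ℕₚ.1+n≰n (subst (_≤ suc (length xs)) (trans (sym (ℕₚ.+-identityʳ k)) eq) (filled⇒≤length h)))
mexFrom-isMex (suc f) k xs 1≤k h eq with k ∈? xs
... | yes k∈ = mexFrom-isMex f (suc k) xs (s≤s z≤n) (filled-suc k∈ h) (trans (sym (ℕₚ.+-suc k f)) eq)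
... | no  k∉ = isMex 1≤k k∉ h

mex-isMex : ∀ xs → IsMex xs (mex xs)
mex-isMex xs = mexFrom-isMex (suc (length xs)) 1 xs (s≤s z≤n) (λ { (suc i) _ (s≤s ()) }) refl

mex≤ : ∀ {m xs} → All (_≤ m) xs → mex xs ≤ suc m
mex≤ {m} {xs} bound with mex xs ≤? suc m
... | yes p = p
... | no  p = ⊥-elim (ℕₚ.1+n≰n (All.lookup bound (IsMex.filled (mex-isMex xs) (suc m) (s≤s z≤n) (ℕₚ.≰⇒> p))))

fullWith : ∀ {m k} → Dec (k ≡ suc m) → ℕ
fullWith (yes _) = 1
fullWith (no _)  = 0

-- For a list with entries at most m, the indicator that all of 1, ..., m occur: the case in which
-- adjoining m + 1 raises the mex.
full : ℕ → List ℕ → ℕ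
full m xs = fullWith (mex xs ≟ suc m)

∉-replicate : ∀ c {x k : ℕ} → k ≢ x → k ∉ replicate c x
∉-replicate (suc c) k≢x (here k≡x) = k≢x k≡x
∉-replicate (suc c) k≢x (there k∈) = ∉-replicate c k≢x k∈

module _ {m : ℕ} {xs : List ℕ} (bound : All (_≤ m) xs) (c : ℕ) where
  open IsMex (mex-isMex xs)

  extended : List ℕ
  extended = replicate (suc c) (suc m) ++ xs

  suc∉ : ∀ {k} → m < k → k ∉ xs
  suc∉ m<k k∈ = ℕₚ.<⇒≱ m<k (All.lookup bound k∈)

  ∉-extended : ∀ {k} → k ≢ suc m → k ∉ xs → k ∉ extended
  ∉-extended k≢ k∉ k∈ with ∈-++⁻ (replicate (suc c) (suc m)) k∈
  ... | inj₁ k∈r = ∉-replicate (suc c) k≢ k∈r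
  ... | inj₂ k∈x = k∉ k∈x

  filled-extended : ∀ {k} → Filled xs k → Filled extended k
  filled-extended h i 1≤i i<k = ∈-++⁺ʳ (replicate (suc c) (suc m)) (h i 1≤i i<k)

  mex-extended : mex extended ≡ mex xs + full m xs
  mex-extended with mex xs ≟ suc m
  ... | yes eq = trans (isMex-unique (mex-isMex extended) (isMex (s≤s z≤n)
                   (∉-extended ℕₚ.1+n≢n (suc∉ (ℕₚ.m≤n⇒m≤1+n (ℕₚ.n<1+n m))))
                   (filled-suc (here refl) (filled-extended (subst (Filled xs) eq filled)))))
                   (trans (ℕₚ.+-comm 1 (suc m)) (cong (_+ 1) (sym eq)))
  ... | no neq = trans (isMex-unique (mex-isMex extended) (isMex positive
                   (∉-extended neq absent) (filled-extended filled)))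
                   (sym (ℕₚ.+-identityʳ _))

  full-extended : full (suc m) extended ≡ full m xs
  full-extended with mex extended ≟ suc (suc m) | mex xs ≟ suc m | mex-extended
  ... | yes _   | yes _   | _  = refl
  ... | no  neq | yes eq′ | eq = ⊥-elim (neq (trans eq (trans (cong (_+ 1) eq′) (ℕₚ.+-comm (suc m) 1))))
  -- Here the mex of `xs` itself would be m + 2, although m + 1 is missing from `xs`.
  ... | yes eq′ | no  neq | eq = ⊥-elim (ℕₚ.1+n≰n (subst (_≤ suc m)
                                   (trans (sym (trans eq (ℕₚ.+-identityʳ _))) eq′) (mex≤ bound)))
  ... | no  _   | no  _   | _  = refl

full-unextended : ∀ {m xs} → All (_≤ m) xs → full (suc m) xs ≡ 0
full-unextended {m} {xs} bound with mex xs ≟ suc (suc m)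
... | yes eq = ⊥-elim (ℕₚ.1+n≰n (subst (_≤ suc m) eq (mex≤ bound)))
... | no  _  = refl

-- The summand of partitionsLE (suc m) n is local to its definition; unification recovers it.
partitions-unfold : ∀ m n → Σ (ℕ → List (List ℕ)) λ f → partitionsLE (suc m) n ≡ concatMap f (upTo (suc n))
partitions-unfold m n = _ , refl

block : ℕ → ℕ → ℕ → List (List ℕ)
block m n = proj₁ (partitions-unfold m n)

guard : ∀ {A : Set} {B : Set} → Dec A → B → B → B
guard (yes _) x y = x
guard (no _)  x y = y

block-eval : ∀ m n c → block m n c ≡
  guard (c * suc m ≤? n) (map (replicate c (suc m) ++_) (partitionsLE m (n ∸ c * suc m))) []
block-eval m n c with c * suc m ≤? n
... | yes _ = refl
... | no  _ = refl

partitionsLE-bounded : ∀ m n → All (All (_≤ m)) (partitionsLE m n)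
partitionsLE-bounded zero    zero    = [] ∷ []
partitionsLE-bounded zero    (suc n) = []
partitionsLE-bounded (suc m) n       = Allₚ.concat⁺ (Allₚ.map⁺ (All.universal bounded (upTo (suc n))))
  where
  bounded : ∀ c → All (All (_≤ suc m)) (block m n c)
  bounded c rewrite block-eval m n c with c * suc m ≤? n
  ... | yes _ = Allₚ.map⁺ (All.map (λ b → Allₚ.++⁺ (Allₚ.replicate⁺ c ℕₚ.≤-refl) (All.map ℕₚ.m≤n⇒m≤1+n b))
                  (partitionsLE-bounded m (n ∸ c * suc m)))
  ... | no  _ = []

sum-applyUpTo-cong : ∀ {f g : ℕ → ℕ} → (∀ c → f c ≡ g c) → ∀ k → sum (applyUpTo f k) ≡ sum (applyUpTo g k)
sum-applyUpTo-cong f≗g zero    = refl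
sum-applyUpTo-cong f≗g (suc k) = cong₂ _+_ (f≗g 0) (sum-applyUpTo-cong (f≗g ∘ suc) k)

sum-applyUpTo-zero : ∀ k → sum (applyUpTo (λ _ → 0) k) ≡ 0
sum-applyUpTo-zero zero    = refl
sum-applyUpTo-zero (suc k) = sum-applyUpTo-zero k

sum-map-concatMap : ∀ {A : Set} (w : List ℕ → ℕ) (f : A → List (List ℕ)) xs →
  sum (map w (concatMap f xs)) ≡ sum (map (sum ∘ map w ∘ f) xs)
sum-map-concatMap w f []       = refl
sum-map-concatMap w f (x ∷ xs) = trans (cong sum (map-++ w (f x) (concatMap f xs)))
  (trans (sum-++ (map w (f x)) _) (cong (_+_ (sum (map w (f x)))) (sum-map-concatMap w f xs)))

-- For d ≥ 1 and k > n this is the coefficient of qⁿ in G(q)/(1 - q^d): the terms with c > n vanish.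
geometric : ℕ → (ℕ → ℕ) → ℕ → ℕ → ℕ
geometric d G k n = sum (applyUpTo (λ c → guard (c * d ≤? n) (G (n ∸ c * d)) 0) k)

guard-shift : ∀ d G c n → guard (suc c * d ≤? n) (G (n ∸ suc c * d)) 0 ≡
  guard (d ≤? n) (guard (c * d ≤? n ∸ d) (G (n ∸ d ∸ c * d)) 0) 0
guard-shift d G c n with suc c * d ≤? n | d ≤? n
... | no  _ | no  _ = refl
... | yes p | no  q = ⊥-elim (q (ℕₚ.m+n≤o⇒m≤o d p))
... | yes p | yes q with c * d ≤? n ∸ d
...   | yes _ = cong G (sym (ℕₚ.∸-+-assoc n d (c * d)))
...   | no  r = ⊥-elim (r (ℕₚ.m+n≤o⇒m≤o∸n (c * d) (subst (_≤ n) (ℕₚ.+-comm d (c * d)) p)))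
guard-shift d G c n | no p | yes q with c * d ≤? n ∸ d
...   | yes r = ⊥-elim (p (subst (_≤ n) (ℕₚ.+-comm (c * d) d) (ℕₚ.m≤o∸n⇒m+n≤o (c * d) q r)))
...   | no  _ = refl

geometric-tail : ∀ d G k n →
  sum (applyUpTo (λ c → guard (suc c * d ≤? n) (G (n ∸ suc c * d)) 0) k) ≡ guard (d ≤? n) (geometric d G k (n ∸ d)) 0
geometric-tail d G k n = trans (sum-applyUpTo-cong (λ c → guard-shift d G c n) k) pull
  where
  pull : sum (applyUpTo (λ c → guard (d ≤? n) (guard (c * d ≤? n ∸ d) (G (n ∸ d ∸ c * d)) 0) 0) k) ≡
    guard (d ≤? n) (geometric d G k (n ∸ d)) 0
  pull with d ≤? n
  ... | yes _ = refl
  ... | no  _ = sum-applyUpTo-zero k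

geometric-suc : ∀ d G k n → geometric d G (suc k) n ≡ G n + guard (d ≤? n) (geometric d G k (n ∸ d)) 0
geometric-suc d G k n = cong (_+_ (G n)) (geometric-tail d G k n)

geometric-stable : ∀ d G k l n → n < k → n < l → geometric (suc d) G k n ≡ geometric (suc d) G l n
geometric-stable d G (suc k) (suc l) n (s≤s n≤k) (s≤s n≤l) =
  trans (geometric-suc (suc d) G k n) (trans (cong (_+_ (G n)) tail) (sym (geometric-suc (suc d) G l n)))
  where
  tail : guard (suc d ≤? n) (geometric (suc d) G k (n ∸ suc d)) 0 ≡ guard (suc d ≤? n) (geometric (suc d) G l (n ∸ suc d)) 0
  tail with suc d ≤? n
  ... | no  _ = refl
  ... | yes d<n = geometric-stable d G k l (n ∸ suc d) (ℕₚ.<-≤-trans n∸<n n≤k) (ℕₚ.<-≤-trans n∸<n n≤l)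
    where
    n∸<n : n ∸ suc d < n
    n∸<n = ℕₚ.∸-monoʳ-< (s≤s z≤n) d<n

-- Weighted sums over partitions with bounded parts

weight : (List ℕ → ℕ) → ℕ → ℕ → ℕ
weight w m n = sum (map w (partitionsLE m n))

weight-cong : ∀ {v w} m → (∀ {xs} → All (_≤ m) xs → v xs ≡ w xs) → ∀ n → weight v m n ≡ weight w m n
weight-cong m v≗w n = cong sum (map-cong-local (All.map v≗w (partitionsLE-bounded m n)))

weight-+ : ∀ v w m n → weight (λ xs → v xs + w xs) m n ≡ weight v m n + weight w m n
weight-+ v w m n = sums (partitionsLE m n)
  where
  rearrange : ∀ a b c d → a + b + (c + d) ≡ a + c + (b + d)
  rearrange = solve-∀
  sums : ∀ xss → sum (map (λ xs → v xs + w xs) xss) ≡ sum (map v xss) + sum (map w xss)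
  sums []         = refl
  sums (xs ∷ xss) = trans (cong (_+_ (v xs + w xs)) (sums xss)) (rearrange (v xs) (w xs) _ _)

weight-zero : ∀ m n → weight (λ _ → 0) m n ≡ 0
weight-zero m n = sums (partitionsLE m n)
  where
  sums : ∀ (xss : List (List ℕ)) → sum (map (λ _ → 0) xss) ≡ 0
  sums []         = refl
  sums (xs ∷ xss) = sums xss

-- The weights in use depend on whether m + 1 occurs but not on how often, so multiplicity 0
-- contributes `w₀` and all positive multiplicities share `w₁`.
weight-suc : ∀ {w w₀ w₁ m} → (∀ {xs} → All (_≤ m) xs → w xs ≡ w₀ xs) →
  (∀ {xs} → All (_≤ m) xs → ∀ c → w (replicate (suc c) (suc m) ++ xs) ≡ w₁ xs) →
  ∀ n → weight w (suc m) n ≡ weight w₀ m n + guard (suc m ≤? n) (geometric (suc m) (weight w₁ m) n (n ∸ suc m)) 0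
weight-suc {w} {w₀} {w₁} {m} h₀ h₁ n = trans (sum-map-concatMap w (block m n) (upTo (suc n)))
  (trans (cong sum (map-applyUpTo id (sum ∘ map w ∘ block m n) (suc n)))
  (cong₂ _+_ (trans (cong sum (sym (map-∘ (partitionsLE m n)))) (weight-cong m h₀ n))
    (trans (sum-applyUpTo-cong terms n) (geometric-tail (suc m) (weight w₁ m) n n))))
  where
  terms : ∀ c → sum (map w (block m n (suc c))) ≡ guard (suc c * suc m ≤? n) (weight w₁ m (n ∸ suc c * suc m)) 0
  terms c rewrite block-eval m n (suc c) with suc c * suc m ≤? n
  ... | yes _ = trans (cong sum (sym (map-∘ (partitionsLE m _)))) (weight-cong m (λ b → h₁ b c) _)
  ... | no  _ = refl

weight-stable : ∀ k n → weight mex (k + n) n ≡ weight mex n n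
weight-stable zero    n = refl
weight-stable (suc k) n = trans (trans (weight-suc {w₀ = mex} (λ _ → refl) mex-extended n) step) (weight-stable k n)
  where
  step : ∀ {x} → weight mex (k + n) n + guard (suc (k + n) ≤? n) x 0 ≡ weight mex (k + n) n
  step with suc (k + n) ≤? n
  ... | yes p = ⊥-elim (ℕₚ.m+n≮n k n p)
  ... | no  _ = ℕₚ.+-identityʳ _

weightSeries : (List ℕ → ℕ) → ℕ → Series
weightSeries w m n = + weight w m n

-- Generating functions of the mex modulo q^(N+1)

module MexSeries (N : ℕ) where
  open CommutativeRing (truncated N) renaming (_+_ to _⊞_; _*_ to _·_; refl to ≈-refl; sym to ≈-sym; trans to ≈-trans; _-_ to _⊟_)
  open IntegerCoefficients (truncated N) using (solve; _:=_; _:+_; _:*_; _:-_; con)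
  open ThetaIdentities (truncated N)
  open Truncated N
  open Supports (truncated N) 𝕢
  open import Relation.Binary.Reasoning.Setoid setoid
  open import Algebra.Properties.CommutativeSemiring.Exp commutativeSemiring using (_^_; ^-homo-*)

  shift-coefficient : ∀ d (a b c : ℕ → ℕ) → (∀ n → a n ≡ b n + guard (d ≤? n) (c (n ∸ d)) 0) →
    (λ n → + a n) ≈ (λ n → + b n) ⊞ 𝕢 ^ d · (λ n → + c n)
  shift-coefficient d a b c h n _ = trans (cong +_ (h n)) (trans (ℤₚ.pos-+ (b n) _) (cong (ℤ._+_ (+ b n)) shifted))
    where
    shifted : + guard (d ≤? n) (c (n ∸ d)) 0 ≡ (𝕢 ^ d ⊛ (λ n → + c n)) n
    shifted with d ≤? n
    ... | yes d≤n = sym (𝕢^⊛-≥ d _ d≤n)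
    ... | no  d≰n = sym (𝕢^⊛-< d _ (ℕₚ.≰⇒> d≰n))

  -- The positive multiplicities contribute QΓ̂, where Γ̂ = V + QΓ̂ and V is the series of `w₁`;
  -- multiplying by 1 - Q eliminates Γ̂.
  weightSeries-suc : ∀ {w w₀ w₁ m} → (∀ {xs} → All (_≤ m) xs → w xs ≡ w₀ xs) →
    (∀ {xs} → All (_≤ m) xs → ∀ c → w (replicate (suc c) (suc m) ++ xs) ≡ w₁ xs) →
    (𝟙 ⊟ 𝕢 ^ suc m) · weightSeries w (suc m) ≈
    (𝟙 ⊟ 𝕢 ^ suc m) · weightSeries w₀ m ⊞ 𝕢 ^ suc m · weightSeries w₁ m
  weightSeries-suc {w} {w₀} {w₁} {m} h₀ h₁ = begin
    (𝟙 ⊟ Q) · weightSeries w (suc m)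
      ≈⟨ *-congˡ (shift-coefficient (suc m) (weight w (suc m)) (weight w₀ m) Γ outer) ⟩
    (𝟙 ⊟ Q) · (weightSeries w₀ m ⊞ Q · Γ̂)
      ≈⟨ solve 3 (λ Q W G → (con (+ 1) :- Q) :* (W :+ Q :* G) := (con (+ 1) :- Q) :* W :+ Q :* (G :- Q :* G))
           ≈-refl Q (weightSeries w₀ m) Γ̂ ⟩
    (𝟙 ⊟ Q) · weightSeries w₀ m ⊞ Q · (Γ̂ ⊟ Q · Γ̂)
      ≈⟨ +-congˡ {(𝟙 ⊟ Q) · weightSeries w₀ m} (*-congˡ {Q} (+-congʳ {⊖ (Q · Γ̂)} (shift-coefficient (suc m) Γ (weight w₁ m) Γ inner))) ⟩
    (𝟙 ⊟ Q) · weightSeries w₀ m ⊞ Q · ((weightSeries w₁ m ⊞ Q · Γ̂) ⊟ Q · Γ̂)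
      ≈⟨ solve 4 (λ Q W V G → (con (+ 1) :- Q) :* W :+ Q :* ((V :+ Q :* G) :- Q :* G) := (con (+ 1) :- Q) :* W :+ Q :* V)
           ≈-refl Q (weightSeries w₀ m) (weightSeries w₁ m) Γ̂ ⟩
    (𝟙 ⊟ Q) · weightSeries w₀ m ⊞ Q · weightSeries w₁ m ∎
    where
    Q Γ̂ : Series
    Q = 𝕢 ^ suc m
    Γ : ℕ → ℕ
    Γ n = geometric (suc m) (weight w₁ m) (suc n) n
    Γ̂ n = + Γ n
    -- The number of summands inherited from degree n is replaced by one that depends on the
    -- argument alone, so that a single function `Γ` appears on both sides of its recurrence.
    restabilise : ∀ n → guard (suc m ≤? n) (geometric (suc m) (weight w₁ m) n (n ∸ suc m)) 0 ≡ guard (suc m ≤? n) (Γ (n ∸ suc m)) 0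
    restabilise n with suc m ≤? n
    ... | yes m<n = geometric-stable m (weight w₁ m) n _ (n ∸ suc m) (ℕₚ.∸-monoʳ-< (s≤s z≤n) m<n) (ℕₚ.n<1+n _)
    ... | no  _   = refl
    outer : ∀ n → weight w (suc m) n ≡ weight w₀ m n + guard (suc m ≤? n) (Γ (n ∸ suc m)) 0
    outer n = trans (weight-suc {w₁ = w₁} h₀ h₁ n) (cong (_+_ _) (restabilise n))
    inner : ∀ n → Γ n ≡ weight w₁ m n + guard (suc m ≤? n) (Γ (n ∸ suc m)) 0
    inner n = trans (geometric-suc (suc m) (weight w₁ m) n n) (cong (_+_ _) (restabilise n))

  mexSeries fullSeries : ℕ → Series
  mexSeries    = weightSeries mex
  fullSeries m = weightSeries (full m) m

  partitionsLE-zero : ∀ {w} → w [] ≡ 1 → weightSeries w 0 ≈ 𝟙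
  partitionsLE-zero {w} h zero    _ = cong +_ (trans (ℕₚ.+-identityʳ (w [])) h)
  partitionsLE-zero h (suc n) _ = refl

  -- Each of the parts 1, ..., m occurs at least once, and the part i contributes qⁱ/(1 - qⁱ).
  fullSeries-product : ∀ m → fullSeries m · qfactorial 𝕢 m ≈ 𝕢 ^ triangle m
  fullSeries-product zero    = ≈-trans (*-identityʳ (fullSeries 0)) (partitionsLE-zero refl)
  fullSeries-product (suc m) = begin
    fullSeries (suc m) · ((𝟙 ⊟ Q) · F)
      ≈⟨ solve 3 (λ A Q F → A :* (Q :* F) := (Q :* A) :* F) ≈-refl (fullSeries (suc m)) (𝟙 ⊟ Q) F ⟩
    ((𝟙 ⊟ Q) · fullSeries (suc m)) · F
      ≈⟨ *-congʳ {F} (weightSeries-suc {w₀ = λ _ → 0} {w₁ = full m} {m = m} full-unextended full-extended) ⟩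
    ((𝟙 ⊟ Q) · weightSeries (λ _ → 0) m ⊞ Q · fullSeries m) · F
      ≈⟨ *-congʳ {F} (+-congʳ {Q · fullSeries m} (*-congˡ {𝟙 ⊟ Q} (λ n _ → cong +_ (weight-zero m n)))) ⟩
    ((𝟙 ⊟ Q) · 𝟘 ⊞ Q · fullSeries m) · F
      ≈⟨ solve 3 (λ A Q F → ((con (+ 1) :- Q) :* con (+ 0) :+ Q :* A) :* F := Q :* (A :* F)) ≈-refl (fullSeries m) Q F ⟩
    Q · (fullSeries m · F)
      ≈⟨ *-congˡ {Q} (fullSeries-product m) ⟩
    Q · 𝕢 ^ triangle m
      ≈⟨ ^-homo-* 𝕢 (suc m) (triangle m) ⟨
    𝕢 ^ triangle (suc m) ∎
    where
    Q F : Series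
    Q = 𝕢 ^ suc m
    F = qfactorial 𝕢 m

  -- With M and A the series of `mex` and `full`, (1 - Q)M + Q(M + A) = M + QA: admitting the part m
  -- + 1 adds exactly the next term of ψ.
  mexSeries-product : ∀ m → mexSeries m · qfactorial 𝕢 m ≈ ψ 𝕢 m
  mexSeries-product zero    = ≈-trans (*-identityʳ (mexSeries 0)) (partitionsLE-zero refl)
  mexSeries-product (suc m) = begin
    mexSeries (suc m) · ((𝟙 ⊟ Q) · F)
      ≈⟨ solve 3 (λ A Q F → A :* (Q :* F) := (Q :* A) :* F) ≈-refl (mexSeries (suc m)) (𝟙 ⊟ Q) F ⟩
    ((𝟙 ⊟ Q) · mexSeries (suc m)) · F
      ≈⟨ *-congʳ {F} (weightSeries-suc {w₀ = mex} {m = m} (λ _ → refl) mex-extended) ⟩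
    ((𝟙 ⊟ Q) · mexSeries m ⊞ Q · weightSeries (λ xs → mex xs + full m xs) m) · F
      ≈⟨ *-congʳ {F} (+-congˡ {(𝟙 ⊟ Q) · mexSeries m} (*-congˡ {Q} (λ n _ → trans (cong +_ (weight-+ mex (full m) m n)) (ℤₚ.pos-+ (weight mex m n) (weight (full m) m n))))) ⟩
    ((𝟙 ⊟ Q) · mexSeries m ⊞ Q · (mexSeries m ⊞ fullSeries m)) · F
      ≈⟨ solve 4 (λ M A Q F → ((con (+ 1) :- Q) :* M :+ Q :* (M :+ A)) :* F := M :* F :+ Q :* (A :* F))
           ≈-refl (mexSeries m) (fullSeries m) Q F ⟩
    mexSeries m · F ⊞ Q · (fullSeries m · F)
      ≈⟨ +-cong (mexSeries-product m) (≈-trans (*-congˡ {Q} (fullSeries-product m)) (≈-sym (^-homo-* 𝕢 (suc m) (triangle m)))) ⟩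
    ψ 𝕢 (suc m) ∎
    where
    Q F : Series
    Q = 𝕢 ^ suc m
    F = qfactorial 𝕢 m

  σmexSeries : Series
  σmexSeries n = + σmex n

  -- In `σmex n` the bound on the parts varies with the degree; the product formula needs one bound
  -- for all degrees up to N.
  σmexSeries≈mexSeries : ∀ {m} → N ≤ m → σmexSeries ≈ mexSeries m
  σmexSeries≈mexSeries {m} N≤m n n≤N = cong +_ (sym (subst (λ k → weight mex k n ≡ σmex n)
    (ℕₚ.m∸n+n≡m (ℕₚ.≤-trans n≤N N≤m)) (weight-stable (m ∸ n) n)))

  σmexSeries-product : σmexSeries · qfactorial 𝕢 N ≈ ψ 𝕢 (double N)
  σmexSeries-product = ≈-trans
    (*-cong (σmexSeries≈mexSeries (subst (N ≤_) (sym (double≡n+n N)) (ℕₚ.m≤m+n N N)))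
      (≈-sym (qfactorial-double 𝕢 N 𝕢-nilpotent)))
    (mexSeries-product (double N))

  4∣σmex : (qfactorial 𝕢 N · qfactorial 𝕢 N) N ≡ 0ℤ → 4 ∣ σmex N
  4∣σmex h = fourfold (S≈f²-mod-4 𝕢 N 𝕢-nilpotent σmexSeries σmexSeries-product)
    where
    four : ∀ y → 0ℤ ℤ.- (y ℤ.+ y ℤ.+ (y ℤ.+ y)) ≡ (ℤ.- y) ℤ.* + 4
    four = ℤ-Solver.solve-∀
    fourfold : (∃ λ Y → σmexSeries ≈ qfactorial 𝕢 N · qfactorial 𝕢 N ⊟ (Y ⊞ Y ⊞ (Y ⊞ Y))) → 4 ∣ σmex N
    fourfold (Y , S≈) = divides ℤ.∣ ℤ.- Y N ∣ (trans (cong ℤ.∣_∣ value) (ℤₚ.abs-* (ℤ.- Y N) (+ 4)))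
      where
      value : + σmex N ≡ (ℤ.- Y N) ℤ.* + 4
      value = trans (S≈ N ℕₚ.≤-refl) (trans (cong (λ z → z ℤ.- (Y N ℤ.+ Y N ℤ.+ (Y N ℤ.+ Y N))) h) (four (Y N)))

  4∣σmex-unless-pentagonal : ¬ Sumset Pentagonal Pentagonal N → 4 ∣ σmex N
  4∣σmex-unless-pentagonal ¬E = 4∣σmex (span-coefficient (span-* span-f span-f) ¬E)
    where
    span-f : Span Pentagonal (qfactorial 𝕢 N)
    span-f = resp (≈-sym (euler 𝕢 N 𝕢-nilpotent)) (span-pentagonalSum 𝕢 (λ e p → monomial {e = e} p) N)

  4∣σmex-unless-square : ¬ Sumset DoublePentagonal PerfectSquare N → 4 ∣ σmex N
  4∣σmex-unless-square ¬E = 4∣σmex (span-coefficient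
      (resp (≈-sym (f²≈Dφ 𝕢 N 𝕢-nilpotent)) (span-* span-D (span-φ N))) ¬E)
    where
    double-pentagonal : ∀ e → Pentagonal e → DoublePentagonal (double e)
    double-pentagonal e (a , a²) = a , trans a² (trans (eq e) (cong (λ d → suc (12 * d)) (sym (double≡n+n e))))
      where
      eq : ∀ e → suc (24 * e) ≡ suc (12 * (e + e))
      eq = solve-∀
    square-nilpotent : (𝕢 · 𝕢) ^ suc N ≈ 𝟘
    square-nilpotent = begin
      (𝕢 · 𝕢) ^ suc N       ≈⟨ ^-double 𝕢 (suc N) ⟨
      𝕢 ^ double (suc N)    ≡⟨ cong (𝕢 ^_) (double≡n+n (suc N)) ⟩
      𝕢 ^ (suc N + suc N)   ≈⟨ vanish 𝕢 N 𝕢-nilpotent (suc N) ⟩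
      𝟘                     ∎
    span-D : Span DoublePentagonal (qfactorial (𝕢 · 𝕢) N)
    span-D = resp (≈-sym (euler (𝕢 · 𝕢) N square-nilpotent))
      (span-pentagonalSum (𝕢 · 𝕢) (λ e p → resp (^-double 𝕢 e) (monomial {e = double e} (double-pentagonal e p))) N)

open import Data.Nat using (_≥_; _^_; _%_; _/_; _!)
open import Data.Nat.DivMod using (m/n*n≡m; m≡m%n+[m/n]*n; m*n/n≡m)
open import Data.Nat.Combinatorics using (_C_; nCn≡1; nCk≡n!/k![n-k]!; k![n∸k]!∣n!)
open import Data.Nat.Primality using (Prime; euclidsLemma; prime⇒nonTrivial; prime⇒nonZero; ¬prime[0]; ¬prime[1])
open import Data.Nat.Induction using (<-rec)
open import Data.Vec.Functional using (Vector)
import Algebra.Properties.CommutativeSemiring.Binomial ℕₚ.+-*-commutativeSemiring as Binomial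
open import Algebra.Properties.Monoid.Sum ℕₚ.+-0-monoid using (sum-init-last) renaming (sum to ∑)
import Algebra.Definitions.RawSemiring ℕ.+-*-rawSemiring as Generic

-- Quadratic forms modulo p

×≡* : ∀ m x → m Generic.× x ≡ m * x
×≡* zero    x = refl
×≡* (suc m) x = cong (_+_ x) (×≡* m x)

^≡^ : ∀ x n → x Generic.^ n ≡ x ^ n
^≡^ x zero    = refl
^≡^ x (suc n) = cong (_*_ x) (^≡^ x n)

∣-∑ : ∀ {d n} (t : Vector ℕ n) → (∀ i → d ∣ t i) → d ∣ ∑ t
∣-∑ {n = zero}  t h = _ ∣0
∣-∑ {n = suc n} t h = ∣m∣n⇒∣m+n (h Fin.zero) (∣-∑ (t ∘ Fin.suc) (h ∘ Fin.suc))

prime∤! : ∀ {p} → Prime p → ∀ {k} → k < p → p ∤ k !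
prime∤! P {zero}  _   p∣1 = ¬prime[1] (subst Prime (∣1⇒≡1 p∣1) P)
prime∤! P {suc k} k<p p∣  with euclidsLemma (suc k) (k !) P p∣
... | inj₁ p∣k  = ℕₚ.<⇒≱ k<p (∣⇒≤ p∣k)
... | inj₂ p∣k! = prime∤! P (ℕₚ.<-trans (ℕₚ.n<1+n k) k<p) p∣k!

-- p divides p! = (p C k) k! (p - k)! but neither of the two factorials.
prime∣C : ∀ {p k} → Prime p → 0 < k → k < p → p ∣ p C k
prime∣C {p@(suc r)} {k} P 0<k k<p with euclidsLemma (p C k) (k ! * (p ∸ k) !) P (subst (p ∣_) (sym product) (m∣m*n (r !)))
  where
  instance _ = k ℕₚ.!* (p ∸ k) !≢0
  product : (p C k) * (k ! * (p ∸ k) !) ≡ p !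
  product = trans (cong (_* (k ! * (p ∸ k) !)) (nCk≡n!/k![n-k]! (ℕₚ.<⇒≤ k<p)))
    (m/n*n≡m (k![n∸k]!∣n! (ℕₚ.<⇒≤ k<p)))
... | inj₁ p∣C = p∣C
... | inj₂ p∣k!! = ⊥-elim ([ prime∤! P k<p , prime∤! P (ℕₚ.∸-monoʳ-< 0<k (ℕₚ.<⇒≤ k<p)) ]′ (euclidsLemma (k !) _ P p∣k!!))

freshman : ∀ {p} → Prime p → ∀ a → ∃ λ t → (a + 1) ^ p ≡ 1 + (t * p + a ^ p)
freshman {zero}      P a = ⊥-elim (¬prime[0] P)
freshman {p@(suc r)} P a = quotient p∣middle , (begin
  (a + 1) ^ p                                 ≡⟨ ^≡^ (a + 1) p ⟨
  (a + 1) Generic.^ p                         ≡⟨ Binomial.theorem p a 1 ⟩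
  term Fin.zero + ∑ (term ∘ Fin.suc)        ≡⟨ cong₂ _+_ first (sum-init-last (term ∘ Fin.suc)) ⟩
  1 + (∑ middle + term (Fin.suc (Fin.fromℕ r)))
                                              ≡⟨ cong (λ x → 1 + x) (cong₂ _+_ (_∣_.equality p∣middle) final) ⟩
  1 + (quotient p∣middle * p + a ^ p)         ∎)
  where
  open ≡.≡-Reasoning
  term : Vector ℕ (suc p)
  term = Binomial.binomialTerm a 1 p
  middle : Vector ℕ r
  middle i = term (Fin.suc (Fin.inject₁ i))
  p∣middle : p ∣ ∑ middle
  p∣middle = ∣-∑ middle λ i → subst (p ∣_) (sym (×≡* (p C suc (toℕ (Fin.inject₁ i))) _))
    (∣m⇒∣m*n _ (prime∣C P (s≤s z≤n) (s≤s (subst (_< r) (sym (Finₚ.toℕ-inject₁ i)) (Finₚ.toℕ<n i)))))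
  1^ : ∀ n → 1 Generic.^ n ≡ 1
  1^ n = trans (^≡^ 1 n) (ℕₚ.^-zeroˡ n)
  first : term Fin.zero ≡ 1
  first = trans (×≡* 1 _) (trans (ℕₚ.*-identityˡ _) (trans (ℕₚ.*-identityˡ _) (1^ p)))
  final : term (Fin.suc (Fin.fromℕ r)) ≡ a ^ p
  final rewrite Finₚ.toℕ-fromℕ r | nCn≡1 p | ℕₚ.n∸n≡0 r =
    trans (ℕₚ.+-identityʳ _) (trans (ℕₚ.*-identityʳ _) (^≡^ a p))

-- aᵖ ≡ a (mod p), stated without subtraction.
fermat : ∀ {r} → Prime (suc r) → ∀ a → suc r ∣ a ^ suc r + r * a
fermat {r} P zero    = subst (suc r ∣_) (sym (ℕₚ.*-zeroʳ r)) (suc r ∣0)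
fermat {r} P (suc a) =
  subst (suc r ∣_) (sym regroup) (∣m∣n⇒∣m+n (∣m∣n⇒∣m+n (n∣m*n t) ∣-refl) (fermat P a))
  where
  t : ℕ
  t = proj₁ (freshman P a)
  identity : ∀ A t r a → 1 + (t * suc r + A) + r * suc a ≡ t * suc r + suc r + (A + r * a)
  identity = solve-∀
  regroup : suc a ^ suc r + r * suc a ≡ t * suc r + suc r + (a ^ suc r + r * a)
  regroup = trans (cong (_+ r * suc a) (trans (cong (_^ suc r) (ℕₚ.+-comm 1 a)) (proj₂ (freshman P a)))) (identity (a ^ suc r) t r a)

x+y∣x^odd+y^odd : ∀ x y k → x + y ∣ x ^ suc (k * 2) + y ^ suc (k * 2)
x+y∣x^odd+y^odd x y zero    = ∣-reflexive (sym (cong₂ _+_ (ℕₚ.*-identityʳ x) (ℕₚ.*-identityʳ y)))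
x+y∣x^odd+y^odd x y (suc k) = ∣m+n∣m⇒∣n
  (subst (x + y ∣_) (identity x y (x ^ suc (k * 2)) (y ^ suc (k * 2))) (m∣m*n _))
  (∣n⇒∣m*n (x * y) (x+y∣x^odd+y^odd x y k))
  where
  identity : ∀ x y X Y → (x + y) * (x * X + y * Y) ≡ x * y * (X + Y) + (x * (x * X) + y * (y * Y))
  identity = solve-∀

-- r is -1 modulo r + 1; this is how the summand `r * a` of `fermat` is used.
∣-pred* : ∀ {r x} → suc r ∣ r * x → suc r ∣ x
∣-pred* {r} {x} h = ∣m+n∣m⇒∣n (subst (suc r ∣_) (ℕₚ.+-comm x (r * x)) (m∣m*n x)) h

prime∣square : ∀ {p a} → Prime p → p ∣ a * a → p ∣ a
prime∣square {a = a} P h = [ id , id ]′ (euclidsLemma a a P h)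

square-power : ∀ a n → (a * a) ^ n ≡ a ^ (n * 2)
square-power a n = trans (cong (_^ n) (cong (_*_ a) (sym (ℕₚ.*-identityʳ a)))) (trans (ℕₚ.^-*-assoc a 2 n) (cong (a ^_) (ℕₚ.*-comm 2 n)))

cube-power : ∀ a n → (a * (a * a)) ^ n ≡ a ^ (n * 3)
cube-power a n = trans (cong (λ b → (a * (a * b)) ^ n) (sym (ℕₚ.*-identityʳ a))) (trans (ℕₚ.^-*-assoc a 3 n) (cong (a ^_) (ℕₚ.*-comm 3 n)))

prime∤small : ∀ {p} → 5 ≤ p → ∀ {d} → .{{NonZero d}} → d < 5 → p ∤ d
prime∤small 5≤p d<5 p∣d = ℕₚ.<⇒≱ d<5 (ℕₚ.≤-trans 5≤p (∣⇒≤ p∣d))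

-- Here p = 4k + 3. As (p - 1)/2 = 2k + 1 is odd, a² + b² divides A + B; Fermat gives aA ≡ a and bB
-- ≡ b, so 0 ≡ ab(A + B) ≡ 2ab modulo p.
prime∣sum-of-squares : ∀ {p} k → p ≡ suc (suc (k * 2) * 2) → Prime p → 5 ≤ p →
  ∀ a b → p ∣ a * a + 1 * (b * b) → p ∣ a × p ∣ b
prime∣sum-of-squares k refl P 5≤p a b h = conclude (euclidsLemma 2 (a * b) P p∣2ab)
  where
  r p A B : ℕ
  r = suc (k * 2) * 2
  p = suc r
  A = (a * a) ^ suc (k * 2)
  B = (b * b) ^ suc (k * 2)
  p∣a²+b² : p ∣ a * a + b * b
  p∣a²+b² = subst (λ z → p ∣ a * a + z) (ℕₚ.*-identityˡ (b * b)) h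
  fermat′ : ∀ c → p ∣ c * (c * c) ^ suc (k * 2) + r * c
  fermat′ c = subst (λ z → p ∣ c * z + r * c) (sym (square-power c (suc (k * 2)))) (fermat P c)
  identity : ∀ a b A B r → (a * A + r * a) * b + (b * B + r * b) * a ≡ a * b * (A + B) + r * (2 * (a * b))
  identity = solve-∀
  p∣2ab : p ∣ 2 * (a * b)
  p∣2ab = ∣-pred* (∣m+n∣m⇒∣n
    (subst (p ∣_) (identity a b A B r) (∣m∣n⇒∣m+n (∣m⇒∣m*n b (fermat′ a)) (∣m⇒∣m*n a (fermat′ b))))
    (∣n⇒∣m*n (a * b) (∣-trans p∣a²+b² (x+y∣x^odd+y^odd (a * a) (b * b) k))))
  conclude : p ∣ 2 ⊎ p ∣ a * b → p ∣ a × p ∣ b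
  conclude (inj₁ p∣2) = ⊥-elim (prime∤small 5≤p (s≤s (s≤s (s≤s z≤n))) p∣2)
  conclude (inj₂ p∣ab) with euclidsLemma a b P p∣ab
  ... | inj₁ p∣a = p∣a , prime∣square P (∣m+n∣m⇒∣n p∣a²+b² (∣m⇒∣m*n a p∣a))
  ... | inj₂ p∣b = prime∣square P (∣m+n∣m⇒∣n (subst (p ∣_) (ℕₚ.+-comm (a * a) (b * b)) p∣a²+b²) (∣m⇒∣m*n b p∣b)) , p∣b

-- With u = x + y and v = 2y one has u³ + v³ = (x + 3y)(x² + 3y²), so -u/v would be a cube root of
-- unity modulo p, while 3 ∤ p - 1.
prime∣x²+3y² : ∀ {p} k → p ≡ suc (suc (suc (k * 2) * 3)) → Prime p → 5 ≤ p →
  ∀ x y → p ∣ x * x + 3 * (y * y) → p ∣ x × p ∣ y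
prime∣x²+3y² k refl P 5≤p x y h = conclude (euclidsLemma (u * v) (u + v) P p∣uv[u+v])
  where
  r p u v U V : ℕ
  r = suc (suc (k * 2) * 3)
  p = suc r
  u = x + y
  v = 2 * y
  -- p = 6k + 5 = 2 + 3(2k + 1), so Fermat reads u²U ≡ u and v²V ≡ v. The odd exponent 2k + 1 makes
  -- u³ + v³ divide U + V, whence 0 ≡ u²v²(U + V) ≡ uv(u + v).
  U = (u * (u * u)) ^ suc (k * 2)
  V = (v * (v * v)) ^ suc (k * 2)
  factorisation : ∀ x y → (x + 3 * y) * (x * x + 3 * (y * y)) ≡
    (x + y) * ((x + y) * (x + y)) + 2 * y * (2 * y * (2 * y))
  factorisation = solve-∀
  p∣u³+v³ : p ∣ u * (u * u) + v * (v * v)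
  p∣u³+v³ = subst (p ∣_) (factorisation x y) (∣n⇒∣m*n (x + 3 * y) h)
  fermat′ : ∀ c → p ∣ c * (c * (c * (c * c)) ^ suc (k * 2)) + r * c
  fermat′ c = subst (λ z → p ∣ c * (c * z) + r * c) (sym (cube-power c (suc (k * 2)))) (fermat P c)
  identity : ∀ u v U V r → (u * (u * U) + r * u) * (v * v) + (v * (v * V) + r * v) * (u * u) ≡
    u * u * (v * v) * (U + V) + r * (u * v * (u + v))
  identity = solve-∀
  p∣uv[u+v] : p ∣ u * v * (u + v)
  p∣uv[u+v] = ∣-pred* (∣m+n∣m⇒∣n
    (subst (p ∣_) (identity u v U V r) (∣m∣n⇒∣m+n (∣m⇒∣m*n (v * v) (fermat′ u)) (∣m⇒∣m*n (u * u) (fermat′ v))))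
    (∣n⇒∣m*n (u * u * (v * v)) (∣-trans p∣u³+v³ (x+y∣x^odd+y^odd (u * (u * u)) (v * (v * v)) k))))
  p∣y⇒ : p ∣ y → p ∣ x × p ∣ y
  p∣y⇒ p∣y = prime∣square P (∣m+n∣m⇒∣n (subst (p ∣_) (ℕₚ.+-comm (x * x) _) h) (∣n⇒∣m*n 3 (∣m⇒∣m*n y p∣y))) , p∣y
  p∣v⇒ : p ∣ v → p ∣ x × p ∣ y
  p∣v⇒ p∣v with euclidsLemma 2 y P p∣v
  ... | inj₁ p∣2 = ⊥-elim (prime∤small 5≤p (s≤s (s≤s (s≤s z≤n))) p∣2)
  ... | inj₂ p∣y = p∣y⇒ p∣y
  p∣v³⇒ : p ∣ v * (v * v) → p ∣ v
  p∣v³⇒ d = [ id , prime∣square P ]′ (euclidsLemma v (v * v) P d)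
  -- If p divides u + v = x + 3y, then x ≡ -3y and x² + 3y² ≡ 12y².
  shifted : ∀ x y → x * x + 3 * (y * y) + (x + y + 2 * y) * (3 * y) ≡ (x + y + 2 * y) * x + 4 * (3 * (y * y))
  shifted = solve-∀
  p∣12y² : p ∣ u + v → p ∣ 4 * (3 * (y * y))
  p∣12y² d = ∣m+n∣m⇒∣n (subst (p ∣_) (shifted x y) (∣m∣n⇒∣m+n h (∣m⇒∣m*n (3 * y) d))) (∣m⇒∣m*n x d)
  conclude : p ∣ u * v ⊎ p ∣ u + v → p ∣ x × p ∣ y
  conclude (inj₁ p∣uv) with euclidsLemma u v P p∣uv
  ... | inj₁ p∣u = p∣v⇒ (p∣v³⇒ (∣m+n∣m⇒∣n p∣u³+v³ (∣m⇒∣m*n (u * u) p∣u)))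
  ... | inj₂ p∣v = p∣v⇒ p∣v
  conclude (inj₂ d) with euclidsLemma 4 (3 * (y * y)) P (p∣12y² d)
  ... | inj₁ p∣4 = ⊥-elim (prime∤small 5≤p (s≤s (s≤s (s≤s (s≤s (s≤s z≤n))))) p∣4)
  ... | inj₂ d′ with euclidsLemma 3 (y * y) P d′
  ...   | inj₁ p∣3  = ⊥-elim (prime∤small 5≤p (s≤s (s≤s (s≤s (s≤s z≤n)))) p∣3)
  ...   | inj₂ p∣y² = p∣y⇒ (prime∣square P p∣y²)

prime∣x²+12y² : ∀ {p} k → p ≡ suc (suc (suc (k * 2) * 3)) → Prime p → 5 ≤ p →
  ∀ x y → p ∣ x * x + 12 * (y * y) → p ∣ x × p ∣ y
prime∣x²+12y² {p} k eq P 5≤p x y h = p∣x , [ ⊥-elim ∘ prime∤small 5≤p (s≤s (s≤s (s≤s z≤n))) , id ]′ (euclidsLemma 2 y P p∣2y)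
  where
  identity : ∀ x y → x * x + 12 * (y * y) ≡ x * x + 3 * (2 * y * (2 * y))
  identity = solve-∀
  both : p ∣ x × p ∣ 2 * y
  both = prime∣x²+3y² k eq P 5≤p x (2 * y) (subst (p ∣_) (identity x y) h)
  p∣x : p ∣ x
  p∣x = proj₁ both
  p∣2y : p ∣ 2 * y
  p∣2y = proj₂ both

module _ {p : ℕ} (P : Prime p) (c : ℕ)
  (anisotropic : ∀ a b → p ∣ a * a + c * (b * b) → p ∣ a × p ∣ b) where

  private instance
    p≢0 : NonZero p
    p≢0 = prime⇒nonZero P

  -- Descent on Q: a representation forces p to divide a and b, so p² divides Q²pt; as p ∤ t, p
  -- divides Q, and everything can be divided by p².
  odd-valuation-not-represented : ∀ {t} → p ∤ t → ∀ Q → 1 ≤ Q → ∀ a b → Q * Q * (p * t) ≢ a * a + c * (b * b)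
  odd-valuation-not-represented {t} p∤t = <-rec _ descend
    where
    cancelled : ∀ a b p → a * p * (a * p) + c * (b * p * (b * p)) ≡ p * (p * (a * a + c * (b * b)))
    cancelled a b p = identity a b p c
      where
      identity : ∀ a b p c → a * p * (a * p) + c * (b * p * (b * p)) ≡ p * (p * (a * a + c * (b * b)))
      identity = solve-∀
    swap : ∀ Q p t → Q * (p * t) ≡ p * (Q * t)
    swap = solve-∀
    scale : ∀ Q p t → Q * p * (Q * p) * t ≡ p * (Q * Q * (p * t))
    scale = solve-∀

    descend : ∀ Q → (∀ {Q′} → Q′ < Q → 1 ≤ Q′ → ∀ a b → Q′ * Q′ * (p * t) ≢ a * a + c * (b * b)) →
      1 ≤ Q → ∀ a b → Q * Q * (p * t) ≢ a * a + c * (b * b)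
    descend Q rec 1≤Q a b eq with anisotropic a b (subst (p ∣_) eq (∣n⇒∣m*n (Q * Q) (m∣m*n t)))
    ... | divides a′ refl , divides b′ refl = reduce (euclidsLemma (Q * Q) t P (subst (p ∣_) (sym Q²t) (m∣m*n _)))
      where
      Q²t : Q * Q * t ≡ p * (a′ * a′ + c * (b′ * b′))
      Q²t = ℕₚ.*-cancelˡ-≡ _ _ p (trans (sym (swap (Q * Q) p t)) (trans eq (cancelled a′ b′ p)))
      smaller : ∀ Q′ → Q ≡ Q′ * p → ⊥
      smaller zero     refl = ℕₚ.1+n≰n 1≤Q
      smaller (suc Q′) refl = rec (ℕₚ.m<m*n (suc Q′) p (ℕ.nonTrivial⇒n>1 p {{prime⇒nonTrivial P}})) (s≤s z≤n) a′ b′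
        (ℕₚ.*-cancelˡ-≡ _ _ p (trans (sym (scale (suc Q′) p t)) Q²t))
      reduce : p ∣ Q * Q ⊎ p ∣ t → ⊥
      reduce (inj₂ p∣t) = p∤t p∣t
      reduce (inj₁ p∣Q²) with prime∣square P p∣Q²
      ... | divides Q′ eq′ = smaller Q′ eq′

-- From residues modulo 12 to the quadratic forms

import Data.Integer.Divisibility as ℤd
import Data.Integer.Divisibility.Signed as ℤs

Admissible : ℕ → Set
Admissible p = Prime p × p ≥ 5 × (p % 12 ≡ 5 ⊎ p % 12 ≡ 7 ⊎ p % 12 ≡ 11)

residue : ∀ p {r} → p % 12 ≡ r → p ≡ r + p / 12 * 12
residue p eq = trans (m≡m%n+[m/n]*n p 12) (cong (_+ p / 12 * 12) eq)

4∣σmex-if-odd-valuation : ∀ {p} → Admissible p → ∀ {N Q t} → 1 ≤ Q → p ∤ t →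
  Q * Q * (p * t) ≡ suc (12 * N) → 4 ∣ σmex N
4∣σmex-if-odd-valuation {p} (P , 5≤p , residues) {N} {Q} {t} 1≤Q p∤t factored = cases residues
  where
  by-x²+12y² : ∀ k → p ≡ suc (suc (suc (k * 2) * 3)) → 4 ∣ σmex N
  by-x²+12y² k eq = MexSeries.4∣σmex-unless-square N λ { (e , _ , (a , a²) , (b , refl) , refl) →
    odd-valuation-not-represented P 12 (prime∣x²+12y² k eq P 5≤p) p∤t Q 1≤Q a b
      (trans factored (sym (trans (cong (_+ 12 * (b * b)) a²) (cong suc (sym (ℕₚ.*-distribˡ-+ 12 e (b * b))))))) }

  by-x²+y² : ∀ k → p ≡ suc (suc (k * 2) * 2) → 4 ∣ σmex N
  by-x²+y² k eq = MexSeries.4∣σmex-unless-pentagonal N λ { (e , e′ , (a , a²) , (b , b²) , refl) →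
    odd-valuation-not-represented P 1 (prime∣sum-of-squares k eq P 5≤p) p∤2t Q 1≤Q a b
      (trans (twice Q p t) (trans (cong (2 *_) factored)
        (trans (sum-of-squares e e′) (sym (cong₂ (λ x y → x + 1 * y) a² b²))))) }
    where
    -- The factor 2 of 2(12N + 1) = a² + b² is absorbed into t.
    p∤2t : p ∤ 2 * t
    p∤2t p∣2t = [ prime∤small 5≤p (s≤s (s≤s (s≤s z≤n))) , p∤t ]′ (euclidsLemma 2 t P p∣2t)
    twice : ∀ Q p t → Q * Q * (p * (2 * t)) ≡ 2 * (Q * Q * (p * t))
    twice = solve-∀
    sum-of-squares : ∀ e e′ → 2 * suc (12 * (e + e′)) ≡ suc (24 * e) + 1 * suc (24 * e′)
    sum-of-squares = solve-∀

  cases : p % 12 ≡ 5 ⊎ p % 12 ≡ 7 ⊎ p % 12 ≡ 11 → 4 ∣ σmex N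
  -- 5 + 12m = 6(2m) + 5, 7 + 12m = 4(1 + 3m) + 3 and 11 + 12m = 6(1 + 2m) + 5. The residue 11 would
  -- suit either form.
  cases (inj₁ r) = by-x²+12y² (2 * (p / 12)) (trans (residue p r) (identity (p / 12)))
    where
    identity : ∀ m → 5 + m * 12 ≡ suc (suc (suc (2 * m * 2) * 3))
    identity = solve-∀
  cases (inj₂ (inj₁ r)) = by-x²+y² (1 + 3 * (p / 12)) (trans (residue p r) (identity (p / 12)))
    where
    identity : ∀ m → 7 + m * 12 ≡ suc (suc ((1 + 3 * m) * 2) * 2)
    identity = solve-∀
  cases (inj₂ (inj₂ r)) = by-x²+12y² (1 + 2 * (p / 12)) (trans (residue p r) (identity (p / 12)))
    where
    identity : ∀ m → 11 + m * 12 ≡ suc (suc (suc ((1 + 2 * m) * 2) * 3))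
    identity = solve-∀

square≡1-mod-12 : ∀ {p} → Admissible p → ∃ λ t → p ^ 2 ≡ suc (12 * t)
square≡1-mod-12 {p} (_ , _ , r) = cases r
  where
  m : ℕ
  m = p / 12
  cases : p % 12 ≡ 5 ⊎ p % 12 ≡ 7 ⊎ p % 12 ≡ 11 → ∃ λ t → p ^ 2 ≡ suc (12 * t)
  cases (inj₁ r) = 2 + 10 * m + 12 * (m * m) , trans (cong (_^ 2) (residue p r)) (identity m)
    where
    identity : ∀ m → (5 + m * 12) * ((5 + m * 12) * 1) ≡ suc (12 * (2 + 10 * m + 12 * (m * m)))
    identity = solve-∀
  cases (inj₂ (inj₁ r)) = 4 + 14 * m + 12 * (m * m) , trans (cong (_^ 2) (residue p r)) (identity m)
    where
    identity : ∀ m → (7 + m * 12) * ((7 + m * 12) * 1) ≡ suc (12 * (4 + 14 * m + 12 * (m * m)))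
    identity = solve-∀
  cases (inj₂ (inj₂ r)) = 10 + 22 * m + 12 * (m * m) , trans (cong (_^ 2) (residue p r)) (identity m)
    where
    identity : ∀ m → (11 + m * 12) * ((11 + m * 12) * 1) ≡ suc (12 * (10 + 22 * m + 12 * (m * m)))
    identity = solve-∀

-- Makes the division by 12 in the argument of the theorem exact.
prodSq≡1-mod-12 : ∀ p k → (∀ i → 1 ≤ i → i ≤ k → Admissible (p i)) → ∃ λ s → prodSq p k ≡ suc (12 * s)
prodSq≡1-mod-12 p zero    h = 0 , refl
prodSq≡1-mod-12 p (suc k) h
  with prodSq≡1-mod-12 p k (λ i 1≤i i≤k → h i 1≤i (ℕₚ.m≤n⇒m≤1+n i≤k)) | square≡1-mod-12 (h (suc k) (s≤s z≤n) ℕₚ.≤-refl)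
... | s , eq | t , eq′ = s + t + 12 * (s * t) , trans (cong₂ _*_ eq eq′) (identity s t)
  where
  identity : ∀ s t → suc (12 * s) * suc (12 * t) ≡ suc (12 * (s + t + 12 * (s * t)))
  identity = solve-∀

prodSq-square : ∀ p k → (∀ i → 1 ≤ i → i ≤ k → Admissible (p i)) → ∃ λ Q → 1 ≤ Q × prodSq p k ≡ Q * Q
prodSq-square p zero    h = 1 , s≤s z≤n , refl
prodSq-square p (suc k) h with prodSq-square p k (λ i 1≤i i≤k → h i 1≤i (ℕₚ.m≤n⇒m≤1+n i≤k)) | h (suc k) (s≤s z≤n) ℕₚ.≤-refl
... | Q , 1≤Q , eq | _ , 5≤p , _ = Q * p (suc k) , ℕₚ.*-mono-≤ 1≤Q (ℕₚ.≤-trans (s≤s z≤n) 5≤p) ,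
  trans (cong (_* (p (suc k) ^ 2)) eq) (identity Q (p (suc k)))
  where
  identity : ∀ Q p → Q * Q * (p * (p * 1)) ≡ Q * p * (Q * p)
  identity = solve-∀

theorem1p1 : (k n : ℕ) (p : ℕ → ℕ) →
    (∀ i → 1 ≤ i → i ≤ suc k →
    Prime (p i) × p i ≥ 5 × (p i % 12 ≡ 5 ⊎ p i % 12 ≡ 7 ⊎ p i % 12 ≡ 11)) →
    (j : ℤ) → ¬ ((+ p (suc k)) ℤd.∣ j) →
    4 ∣ σmexℤ ((+ (prodSq p (suc k) * n))
    ℤ.+ (+ (prodSq p k * p (suc k))) ℤ.* j
    ℤ.+ (+ ((prodSq p (suc k) ∸ 1) / 12)))
theorem1p1 k n p h j p∤j = bySign _ refl
  where
  p′ : ℕ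
  p′ = p (suc k)

  adm : Admissible p′
  adm = h (suc k) (s≤s z≤n) ℕₚ.≤-refl

  square : ∃ λ Q → 1 ≤ Q × prodSq p k ≡ Q * Q
  square = prodSq-square p k (λ i 1≤i i≤k → h i 1≤i (ℕₚ.m≤n⇒m≤1+n i≤k))

  Q : ℕ
  Q = proj₁ square

  offset : ∃ λ s → prodSq p (suc k) ≡ suc (12 * s)
  offset = prodSq≡1-mod-12 p (suc k) h

  s : ℕ
  s = (prodSq p (suc k) ∸ 1) / 12

  12s+1 : suc (12 * s) ≡ prodSq p (suc k)
  12s+1 = trans (cong (λ x → suc (12 * x)) (trans (cong (λ x → (x ∸ 1) / 12) (proj₂ offset))
    (trans (cong (_/ 12) (ℕₚ.*-comm 12 (proj₁ offset))) (m*n/n≡m (proj₁ offset) 12)))) (sym (proj₂ offset))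

  -- The cofactor in 12 · `argument` + 1 = Q²pt. It is congruent to 12j modulo p.
  t : ℤ
  t = (+ 12) ℤ.* (+ p′) ℤ.* (+ n) ℤ.+ (+ 12) ℤ.* j ℤ.+ (+ p′)

  p∤12 : p′ ∤ 12
  p∤12 p∣12 = [ prime∤small (proj₁ (proj₂ adm)) (s≤s (s≤s (s≤s (s≤s (s≤s z≤n))))) ,
    prime∤small (proj₁ (proj₂ adm)) (s≤s (s≤s (s≤s (s≤s z≤n)))) ]′ (euclidsLemma 4 3 (proj₁ adm) p∣12)

  p∤t : p′ ∤ ℤ.∣ t ∣
  p∤t p∣t = [ p∤12 , p∤j ]′
    (euclidsLemma 12 ℤ.∣ j ∣ (proj₁ adm) (subst (p′ ∣_) (ℤₚ.abs-* (+ 12) j) (ℤs.∣⇒∣ᵤ p∣12j)))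
    where
    identity : ∀ p n j → (+ 12) ℤ.* p ℤ.* n ℤ.+ (+ 12) ℤ.* j ℤ.+ p ≡
      p ℤ.* ((+ 12) ℤ.* n ℤ.+ (+ 1)) ℤ.+ (+ 12) ℤ.* j
    identity = ℤ-Solver.solve-∀
    p∣12j : + p′ ℤs.∣ (+ 12) ℤ.* j
    p∣12j = ℤs.∣m+n∣m⇒∣n
      (subst (+ p′ ℤs.∣_) (identity (+ p′) (+ n) j) (ℤs.∣ᵤ⇒∣ p∣t))
      (ℤs.∣m⇒∣m*n ((+ 12) ℤ.* (+ n) ℤ.+ (+ 1)) ℤs.∣-refl)

  argument : ℤ
  argument = (+ (prodSq p (suc k) * n)) ℤ.+ (+ (prodSq p k * p′)) ℤ.* j ℤ.+ (+ s)

  factored : (+ 12) ℤ.* argument ℤ.+ (+ 1) ≡ (+ (Q * Q * p′)) ℤ.* t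
  factored = trans (cong (λ x → (+ 12) ℤ.* x ℤ.+ (+ 1)) (cong₂ (λ x y → x ℤ.+ y ℤ.* j ℤ.+ (+ s)) lift₁ lift₂))
    (trans (identity₁ A p̂ (+ n) j (+ s)) (trans (cong (ℤ._+_ ((+ 12) ℤ.* (A ℤ.* (p̂ ℤ.* p̂) ℤ.* (+ n) ℤ.+ A ℤ.* p̂ ℤ.* j))) lift₃) (trans (identity₂ A p̂ (+ n) j) (cong (ℤ._* t) lift₄))))
    where
    A p̂ : ℤ
    A = + (Q * Q)
    p̂ = + p′
    P≡ : prodSq p (suc k) ≡ Q * Q * (p′ * p′)
    P≡ = cong₂ _*_ (proj₂ (proj₂ square)) (cong (_*_ p′) (ℕₚ.*-identityʳ p′))
    lift₀ : + (prodSq p (suc k)) ≡ A ℤ.* (p̂ ℤ.* p̂)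
    lift₀ = trans (cong +_ P≡) (trans (ℤₚ.pos-* (Q * Q) (p′ * p′)) (cong (ℤ._*_ A) (ℤₚ.pos-* p′ p′)))
    lift₁ : + (prodSq p (suc k) * n) ≡ A ℤ.* (p̂ ℤ.* p̂) ℤ.* (+ n)
    lift₁ = trans (ℤₚ.pos-* (prodSq p (suc k)) n) (cong (ℤ._* (+ n)) lift₀)
    lift₂ : + (prodSq p k * p′) ≡ A ℤ.* p̂
    lift₂ = trans (ℤₚ.pos-* (prodSq p k) p′) (cong (λ x → (+ x) ℤ.* p̂) (proj₂ (proj₂ square)))
    lift₃ : (+ 12) ℤ.* (+ s) ℤ.+ (+ 1) ≡ A ℤ.* (p̂ ℤ.* p̂)
    lift₃ = trans (cong (ℤ._+ (+ 1)) (sym (ℤₚ.pos-* 12 s)))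
      (trans (sym (ℤₚ.pos-+ (12 * s) 1)) (trans (cong +_ (trans (ℕₚ.+-comm (12 * s) 1) 12s+1)) lift₀))
    lift₄ : A ℤ.* p̂ ≡ + (Q * Q * p′)
    lift₄ = sym (ℤₚ.pos-* (Q * Q) p′)
    identity₁ : ∀ A p n j s → (+ 12) ℤ.* (A ℤ.* (p ℤ.* p) ℤ.* n ℤ.+ A ℤ.* p ℤ.* j ℤ.+ s) ℤ.+ (+ 1) ≡
      (+ 12) ℤ.* (A ℤ.* (p ℤ.* p) ℤ.* n ℤ.+ A ℤ.* p ℤ.* j) ℤ.+ ((+ 12) ℤ.* s ℤ.+ (+ 1))
    identity₁ = ℤ-Solver.solve-∀
    identity₂ : ∀ A p n j → (+ 12) ℤ.* (A ℤ.* (p ℤ.* p) ℤ.* n ℤ.+ A ℤ.* p ℤ.* j) ℤ.+ A ℤ.* (p ℤ.* p) ≡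
      A ℤ.* p ℤ.* ((+ 12) ℤ.* p ℤ.* n ℤ.+ (+ 12) ℤ.* j ℤ.+ p)
    identity₂ = ℤ-Solver.solve-∀

  -- A negative argument gives the value 0. Otherwise `factored` is carried to ℕ by absolute values,
  -- which avoids determining the sign of t.
  bySign : ∀ z → z ≡ argument → 4 ∣ σmexℤ z
  bySign -[1+ _ ] _  = 4 ∣0
  bySign (+ N)    eq = 4∣σmex-if-odd-valuation adm {N} {Q} {ℤ.∣ t ∣} (proj₁ (proj₂ square)) p∤t
    (trans (sym (ℕₚ.*-assoc (Q * Q) p′ ℤ.∣ t ∣)) (trans (sym (ℤₚ.abs-* (+ (Q * Q * p′)) t))
      (trans (cong ℤ.∣_∣ (sym factored)) (cong ℤ.∣_∣ (trans (cong (λ x → (+ 12) ℤ.* x ℤ.+ (+ 1)) (sym eq)) lift)))))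
    where
    lift : (+ 12) ℤ.* (+ N) ℤ.+ (+ 1) ≡ + suc (12 * N)
    lift = trans (cong (ℤ._+ (+ 1)) (sym (ℤₚ.pos-* 12 N))) (trans (sym (ℤₚ.pos-+ (12 * N) 1)) (cong +_ (ℕₚ.+-comm (12 * N) 1)))
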